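{- Let $N\ge1$, $T\ge1$, $0\le S\le T-1$ be integers and let $X\in\Omega(N,T,S)$. Let $Y=(Y(0),\dots,Y(T))$ be the random sequence produced from $X$ by the $S\mapsto S+1$ algorithm described in the context. Then $Y\in\Omega(N,T,S+1)$ almost surely and its law is the row of the matrix $P^S_{S\mapsto S+1}$ (defined in the context) indexed by $X$: for every $Y'\in\Omega(N,T,S+1)$, $$\mathrm{Prob}\{Y=Y'\}=P^S_{S\mapsto S+1}(X,Y').$$
   Context: Fix integers $N\ge1$, $T\ge1$. For an integer $0\le S\le T$, $\Omega(N,T,S)$ is the set of families of $N$ non-intersecting lattice paths $\tau_1,\dots,\tau_N:\{0,1,\dots,T\}\to\mathbb Z$ with $\tau_i(0)=i-1$, $\tau_i(T)=S+i-1$, $\tau_i(t+1)-\tau_i(t)\in\{0,1\}$ and $\tau_1(t)<\dots<\tau_N(t)$ for all $t$. Such a family is identified with the sequence $X=(X(0),X(1),\dots,X(T))$, $X(t)=(\tau_1(t),\dots,\tau_N(t))$. For $0\le S,t\le T$ put $$\mathfrak X^{S,t}=\{x\in\mathbb Z:\max(0,t+S-T)\le x\le\min(t+N-1,S+N-1)\},$$ $$\mathcal X^{S,t}=\{(x_1,\dots,x_N)\in(\mathfrak X^{S,t})^N: x_1<\dots<x_N\}.$$ $(a)_k=a(a+1)\cdots(a+k-1)$. Matrix $P^{S,t}_{t+}$ ($0\le t\le T-1$), of size $|\mathcal X^{S,t}|\times|\mathcal X^{S,t+1}|$: $$P^{S,t}_{t+}(X,Y)=\frac{\prod_{i<j}(y_j-y_i)\prod_{i:y_i=x_i+1}(N+S-x_i-1)\prod_{i:y_i=x_i}(x_i+T-t-S)}{(T-t)_N\prod_{i<j}(x_j-x_i)}$$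 if $y_i-x_i\in\{0,1\}$ for all $i$, and $0$ otherwise. Matrix $P^{S,t}_{S- }$ ($1\le S\le T$), of size $|\mathcal X^{S,t}|\times|\mathcal X^{S-1,t}|$: $$P^{S,t}_{S- }(X,Y)=\frac{\prod_{i<j}(y_j-y_i)\prod_{i:y_i=x_i-1}x_i\prod_{i:y_i=x_i}(S+N-1-x_i)}{(S)_N\prod_{i<j}(x_j-x_i)}$$ if $y_i-x_i\in\{ -1,0\}$ for all $i$, and $0$ otherwise. For $0\le S\le T-1$, $X\in\Omega(N,T,S)$, $Y\in\Omega(N,T,S+1)$ define $$P^S_{S\mapsto S+1}(X,Y)=\prod_{t=0}^{T-1}\frac{P^{S+1,t}_{t+}(Y(t),Y(t+1))\,P^{S+1,t+1}_{S- }(Y(t+1),X(t+1))}{(P^{S+1,t}_{t+}P^{S+1,t+1}_{S- })(Y(t),X(t+1))}$$ if $\prod_{t=0}^{T-1}(P^{S+1,t}_{t+}P^{S+1,t+1}_{S- })(Y(t),X(t+1))>0$, and $0$ otherwise. Distribution $D(a,b,n)$: the probability distribution on $\{0,1,\dots,n\}$ with $$D(a,b,n)\{k\}=\frac{a(a+1)\cdots(a+k-1)\,(b+k)\cdots(b+n-1)}{\sum_{j=0}^n a(a+1)\cdots(a+j-1)\,(b+j)\cdots(b+n-1)}.$$ Algorithm ($S\mapsto S+1$). Input $X=(X(0),\dots,X(T))\in\Omega(N,T,S)$. Set $Y(0)=(0,1,\dots,N-1)$. For $t=0,1,\dots,T-1$ successively, construct $Y(t+1)=(z_1<\dots<z_N)$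 from $Y(t)=(y_1<\dots<y_N)$ and $X(t+1)=(x_1<\dots<x_N)$ as follows (it always holds that $x_i-y_i\in\{ -1,0,1\}$): (1) for all $i$ with $x_i-y_i=1$ set $z_i=x_i$; (2) for all $i$ with $x_i-y_i=-1$ set $z_i=y_i$; (3) take all $i$ with $x_i=y_i$ and split the set of the corresponding integers $x_i$ into maximal blocks of consecutive integers. A block $\{k,k+1,\dots,k+l-1\}$, with smallest element $k$ and size $l$, is called a $(k,l)$-block. For each $(k,l)$-block take a random variable $\xi$ with distribution $D(k+T-t-S-1,\,k+1,\,l)$; the variables $\xi$ for different blocks (and different $t$) are sampled independently. Set $z_i=x_i$ for the $\xi$ smallest elements $x_i$ of the block, and $z_i=x_i+1$ for the remaining elements of the block. -}

module Defs where

open import Data.Bool.Base using (if_then_else_)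
open import Data.Fin.Base as Fin using (Fin; toℕ; inject₁; fromℕ)
import Data.Fin.Properties as Fin
import Data.Integer.Base as ℤ
open import Data.Integer.Base using (ℤ; +_; -[1+_]; 0ℤ; 1ℤ; -1ℤ; _+_; _-_; _≤_; _<_; _⊔_; _⊓_)
import Data.Integer.Properties as ℤ
open import Data.List.Base using (List; []; _∷_; _++_; map; filter; foldr; upTo; cartesianProductWith)
open import Data.List.Membership.DecPropositional ℤ._≟_ using (_∈?_)
import Data.Nat.Base as ℕ
open import Data.Nat.Base using (ℕ; zero; suc; _∸_)
open import Data.Product.Base using (_×_; _,_)
open import Data.Rational.Base using (ℚ; 0ℚ; 1ℚ; _/_; _÷_; _*_; ≢-nonZero)
import Data.Rational.Base as ℚ
import Data.Rational.Properties as ℚ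
open import Data.Sum.Base using (_⊎_)
open import Data.Vec.Base using (Vec; []; _∷_; lookup; tail; tabulate)
import Data.Vec.Properties as Vec
open import Level using (0ℓ)
open import Relation.Binary.Definitions using (DecidableEquality)
open import Relation.Binary.PropositionalEquality using (_≡_)
open import Relation.Nullary.Decidable using (Dec; yes; no; does; map′; _×-dec_; _⊎-dec_; _→-dec_)
open import Relation.Unary using (Pred; Decidable)

open import Algebra.Properties.CommutativeMonoid.Sum ℚ.+-0-commutativeMonoid
  using () renaming (sum to Σℚ)
open import Algebra.Properties.CommutativeMonoid.Sum ℚ.*-1-commutativeMonoid
  using () renaming (sum to Πℚ)
open import Algebra.Properties.CommutativeMonoid.Sum ℤ.*-1-commutativeMonoid
  using () renaming (sum to Πℤ)

ι : ℤ → ℚ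
ι z = z / 1

-- Division extended by p ÷₀ 0 = 0.
infixl 7 _÷₀_
_÷₀_ : ℚ → ℚ → ℚ
p ÷₀ q with q ℚ.≟ 0ℚ
... | yes _   = 0ℚ
... | no  q≢0 = _÷_ p q {{≢-nonZero q≢0}}

-- (a)ₖ = a (a + 1) ⋯ (a + k - 1)
rising : ℕ → ℕ → ℕ
rising a zero    = 1
rising a (suc k) = a ℕ.* rising (suc a) k

factor-if : {P : Set} → Dec P → ℤ → ℤ
factor-if P? z = if does P? then z else 1ℤ

-- Particle i ∈ {1,…,N} is indexed by the element i - 1 of Fin N.
Configuration : ℕ → Set
Configuration N = Vec ℤ N

Family : ℕ → ℕ → Set
Family N T = Vec (Configuration N) (suc T)

infix 4 _≟ᶠ_
_≟ᶠ_ : ∀ {N T} → DecidableEquality (Family N T)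
_≟ᶠ_ = Vec.≡-dec (Vec.≡-dec ℤ._≟_)

Increasing : ∀ {N} → Pred (Configuration N) 0ℓ
Increasing x = ∀ i j → i Fin.< j → lookup x i < lookup x j

increasing? : ∀ {N} → Decidable (Increasing {N})
increasing? x = Fin.all? λ i → Fin.all? λ j →
  (i Fin.<? j) →-dec (lookup x i ℤ.<? lookup x j)

-- yᵢ - xᵢ ∈ {0 , 1} for all i
UpStep : ∀ {N} → Configuration N → Configuration N → Set
UpStep x y = ∀ i → lookup y i - lookup x i ≡ 0ℤ ⊎ lookup y i - lookup x i ≡ 1ℤ

upStep? : ∀ {N} (x y : Configuration N) → Dec (UpStep x y)
upStep? x y = Fin.all? λ i →
  (lookup y i - lookup x i ℤ.≟ 0ℤ) ⊎-dec (lookup y i - lookup x i ℤ.≟ 1ℤ)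

-- yᵢ - xᵢ ∈ {-1 , 0} for all i
DownStep : ∀ {N} → Configuration N → Configuration N → Set
DownStep x y = ∀ i → lookup y i - lookup x i ≡ -1ℤ ⊎ lookup y i - lookup x i ≡ 0ℤ

downStep? : ∀ {N} (x y : Configuration N) → Dec (DownStep x y)
downStep? x y = Fin.all? λ i →
  (lookup y i - lookup x i ℤ.≟ -1ℤ) ⊎-dec (lookup y i - lookup x i ℤ.≟ 0ℤ)

record Ω (N T S : ℕ) (X : Family N T) : Set where
  field
    start      : ∀ i → lookup (lookup X Fin.zero) i ≡ + toℕ i
    end        : ∀ i → lookup (lookup X (fromℕ T)) i ≡ + S + + toℕ i
    steps      : ∀ (t : Fin T) → UpStep (lookup X (inject₁ t)) (lookup X (Fin.suc t))
    increasing : ∀ t → Increasing (lookup X t)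

Ω? : ∀ N T S → Decidable (Ω N T S)
Ω? N T S X = map′
  (λ (a , b , c , d) → record { start = a ; end = b ; steps = c ; increasing = d })
  (λ X∈Ω → let open Ω X∈Ω in start , end , steps , increasing)
  ((Fin.all? λ i → lookup (lookup X Fin.zero) i ℤ.≟ + toℕ i) ×-dec
   (Fin.all? λ i → lookup (lookup X (fromℕ T)) i ℤ.≟ + S + + toℕ i) ×-dec
   (Fin.all? λ t → upStep? (lookup X (inject₁ t)) (lookup X (Fin.suc t))) ×-dec
   (Fin.all? λ t → increasing? (lookup X t)))

vectors : {A : Set} (n : ℕ) → List A → List (Vec A n)
vectors zero    as = [] ∷ []
vectors (suc n) as = cartesianProductWith _∷_ as (vectors n as)

module _ (N T : ℕ) where

  -- The points x with max(0, t+S-T) ≤ x ≤ min(t+N-1, S+N-1); all of them lie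
  -- in {0,…,S+N-1}.
  𝔛 : (S t : ℕ) → List ℤ
  𝔛 S t = filter
    (λ x → (0ℤ ⊔ (+ t + + S - + T) ℤ.≤? x) ×-dec
           (x ℤ.≤? (+ t + + N - 1ℤ) ⊓ (+ S + + N - 1ℤ)))
    (map +_ (upTo (S ℕ.+ N)))

  𝒳 : (S t : ℕ) → List (Configuration N)
  𝒳 S t = filter increasing? (vectors N (𝔛 S t))

  -- ∏_{i<j} (xⱼ - xᵢ)
  Δ : Configuration N → ℤ
  Δ x = Πℤ λ i → Πℤ λ j → factor-if (i Fin.<? j) (lookup x j - lookup x i)

  -- The matrices are given by functions on all pairs of configurations; the
  -- entries that belong to the matrix are those with x ∈ 𝒳 S t and
  -- y ∈ 𝒳 S (t+1), respectively y ∈ 𝒳 (S-1) t.  For these, with t < T,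
  -- respectively 1 ≤ S ≤ T, the denominators are positive.
  P-t+ : (S t : ℕ) → Configuration N → Configuration N → ℚ
  P-t+ S t x y =
    if does (upStep? x y)
    then ι (Δ y
            ℤ.* (Πℤ λ i → factor-if (lookup y i ℤ.≟ lookup x i + 1ℤ)
                           (+ N + + S - lookup x i - 1ℤ))
            ℤ.* (Πℤ λ i → factor-if (lookup y i ℤ.≟ lookup x i)
                           (lookup x i + + T - + t - + S)))
         ÷₀ ι (+ rising (T ∸ t) N ℤ.* Δ x)
    else 0ℚ

  P-S- : (S t : ℕ) → Configuration N → Configuration N → ℚ
  P-S- S t x y =
    if does (downStep? x y)
    then ι (Δ y
            ℤ.* (Πℤ λ i → factor-if (lookup y i ℤ.≟ lookup x i - 1ℤ)
                           (lookup x i))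
            ℤ.* (Πℤ λ i → factor-if (lookup y i ℤ.≟ lookup x i)
                           (+ S + + N - 1ℤ - lookup x i)))
         ÷₀ ι (+ rising S N ℤ.* Δ x)
    else 0ℚ

  -- P^{S,t}_{t+} P^{S,t+1}_{S-}
  PP : (S t : ℕ) → Configuration N → Configuration N → ℚ
  PP S t y x =
    foldr ℚ._+_ 0ℚ (map (λ z → P-t+ S t y z * P-S- S (suc t) z x) (𝒳 S (suc t)))

  P-S↦S+1 : (S : ℕ) → Family N T → Family N T → ℚ
  P-S↦S+1 S X Y =
    if does (0ℚ ℚ.<? Πℚ denominator)
    then Πℚ (λ t → numerator t ÷₀ denominator t)
    else 0ℚ
    where
    numerator denominator : Fin T → ℚ
    numerator t =
      P-t+ (suc S) (toℕ t) (lookup Y (inject₁ t)) (lookup Y (Fin.suc t))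
      * P-S- (suc S) (suc (toℕ t)) (lookup Y (Fin.suc t)) (lookup X (Fin.suc t))
    denominator t = PP (suc S) (toℕ t) (lookup Y (inject₁ t)) (lookup X (Fin.suc t))

-- 'draw n μ κ' samples k ∈ {0,…,n} with probability μ k, independently of all
-- earlier draws, and continues with κ k.  'stuck' is a computation that has no
-- result; it contributes to no event.
data Random (A : Set) : Set where
  return : A → Random A
  draw   : (n : ℕ) (μ : Fin (suc n) → ℚ) (κ : Fin (suc n) → Random A) → Random A
  stuck  : Random A

infixl 1 _>>=_
_>>=_ : {A B : Set} → Random A → (A → Random B) → Random B
return a   >>= f = f a
draw n μ κ >>= f = draw n μ (λ k → κ k >>= f)
stuck      >>= f = stuck

Prob : {A : Set} {P : Pred A 0ℓ} → Random A → Decidable P → ℚ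
Prob (return a)   P? = if does (P? a) then 1ℚ else 0ℚ
Prob (draw n μ κ) P? = Σℚ λ k → μ k * Prob (κ k) P?
Prob stuck        P? = 0ℚ

-- A probability distribution on {0,…,n} if b ≥ 1: the normalising sum is then
-- positive, since its term j = 0 is (b)ₙ.  Here (b+j)⋯(b+n-1) = (b+j)ₙ₋ⱼ.
D : (a b n : ℕ) → Fin (suc n) → ℚ
D a b n k = weight k ÷₀ Σℚ weight
  where
  weight : Fin (suc n) → ℚ
  weight j = ι (+ (rising a (toℕ j) ℕ.* rising (b ℕ.+ toℕ j) (n ∸ toℕ j)))

sampleD : (a b : ℤ) (n : ℕ) → Random (Fin (suc n))
sampleD (+ a) (+ b) n = draw n (D a b n) return
sampleD _     _     n = stuck

coincidences : ∀ {N} → Configuration N → Configuration N → List ℤ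
coincidences []       []       = []
coincidences (y ∷ ys) (x ∷ xs) =
  if does (x ℤ.≟ y) then x ∷ coincidences ys xs else coincidences ys xs

-- The pairs (k , l) for the maximal blocks {k,…,k+l-1} of consecutive integers
-- in an increasing list.
blocks : List ℤ → List (ℤ × ℕ)
blocks []       = []
blocks (x ∷ xs) with blocks xs
... | []           = (x , 1) ∷ []
... | (k , l) ∷ bs =
  if does (k ℤ.≟ x + 1ℤ) then (x , suc l) ∷ bs else (x , 1) ∷ (k , l) ∷ bs

module _ (N T S : ℕ) where

  -- Samples one ξ for every block and returns the points that do not jump: the
  -- ξ smallest ones of every block.
  stayingPoints : (t : ℕ) → List (ℤ × ℕ) → Random (List ℤ)
  stayingPoints t []             = return []
  stayingPoints t ((k , l) ∷ bs) =
    sampleD (k + + T - + t - + S - 1ℤ) (k + 1ℤ) l >>= λ ξ →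
    stayingPoints t bs >>= λ stay →
    return (map (λ j → k + + j) (upTo (toℕ ξ)) ++ stay)

  -- zᵢ from yᵢ and xᵢ; the computation is stuck if xᵢ - yᵢ ∉ {-1,0,1}.
  newPoint : List ℤ → ℤ → ℤ → Random ℤ
  newPoint stay y x =
    if does (x - y ℤ.≟ 1ℤ)  then return x else
    if does (x - y ℤ.≟ -1ℤ) then return y else
    if does (x ℤ.≟ y)       then return (if does (x ∈? stay) then x else x + 1ℤ) else
    stuck

  newPoints : ∀ {n} → List ℤ → Configuration n → Configuration n → Random (Configuration n)
  newPoints stay []       []       = return []
  newPoints stay (y ∷ ys) (x ∷ xs) =
    newPoint stay y x >>= λ z →
    newPoints stay ys xs >>= λ zs →
    return (z ∷ zs)

  -- Y(t+1) from Y(t) and X(t+1)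
  step : (t : ℕ) → Configuration N → Configuration N → Random (Configuration N)
  step t y x =
    stayingPoints t (blocks (coincidences y x)) >>= λ stay →
    newPoints stay y x

  -- (Y(t+1),…,Y(t+m)) from Y(t) and (X(t+1),…,X(t+m))
  run : ∀ {m} (t : ℕ) → Configuration N → Vec (Configuration N) m →
        Random (Vec (Configuration N) m)
  run t y []       = return []
  run t y (x ∷ xs) =
    step t y x >>= λ z →
    run (suc t) z xs >>= λ zs →
    return (z ∷ zs)

  algorithm : Family N T → Random (Family N T)
  algorithm X = run 0 y₀ (tail X) >>= λ ys → return (y₀ ∷ ys)
    where
    y₀ : Configuration N
    y₀ = tabulate λ i → + toℕ i

{-# OPTIONS --safe #-}

-- Fix t, y = Y(t) and x = X(t+1).  In P_{t+}(y,z) P_{S-}(z,x) the Vandermonde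
-- factor of z cancels, and what remains is a product over the particles.  A
-- particle with x_i ≠ y_i has z_i forced and contributes a positive constant; one
-- with x_i = y_i contributes, up to a positive constant, x_i + T - t - S - 1 if it
-- stays and x_i + 1 if it jumps.  Since z is increasing, within a block the
-- stayers precede the jumpers, and the product over a (k , l)-block with ξ
-- stayers is the weight of ξ in D(k + T - t - S - 1, k + 1, l).  Hence the law of
-- one step is proportional to P_{t+} P_{S-}; as the step almost surely ends in 𝒳,
-- summing over z identifies the constant with the entry (P_{t+} P_{S-})(y,x).
module Submission where

open import Algebra.Bundles using (CommutativeRing)
open import Data.Bool.Base using (Bool; true; false; if_then_else_)
open import Data.Empty using (⊥)
open import Data.Fin.Base as Fin using (Fin; toℕ; inject₁; fromℕ)
import Data.Fin.Properties as Fin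
open import Data.Integer.Base as ℤ using (ℤ; +_; 0ℤ; 1ℤ; -1ℤ; _+_; _-_)
  renaming (_*_ to _*ᶻ_; _≤_ to _≤ᶻ_; _<_ to _<ᶻ_)
import Data.Integer.Properties as ℤ
open import Data.Integer.Tactic.RingSolver using (solve-∀)
open import Data.List.Base using (List; []; _∷_; _++_; map; foldr; upTo; applyUpTo)
open import Data.List.Membership.DecPropositional ℤ._≟_ using (_∈?_)
open import Data.List.Membership.Propositional using () renaming (_∈_ to _∈ˡ_; _∉_ to _∉ˡ_)
open import Data.List.Membership.Propositional.Properties
  using (∈-++⁺ˡ; ∈-++⁺ʳ; ∈-++⁻; ∈-map⁺; ∈-upTo⁺; ∈-filter⁺; ∈-filter⁻; ∈-cartesianProductWith⁺)
import Data.List.Properties as List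
open import Data.List.Relation.Unary.All as All using (All; []; _∷_)
open import Data.List.Relation.Unary.AllPairs using ([]; _∷_)
open import Data.List.Relation.Unary.Any using (here; there)
open import Data.List.Relation.Unary.Unique.Propositional using (Unique)
import Data.List.Relation.Unary.Unique.Propositional.Properties as Unique
open import Data.Nat.Base as ℕ using (ℕ; zero; suc; _≤_; _<_)
import Data.Nat.Properties as ℕ
open import Data.Product.Base using (∃; _×_; _,_; proj₁; proj₂)
open import Data.Rational.Base as ℚ using (ℚ; 0ℚ; 1ℚ; _*_)
import Data.Rational.Properties as ℚ
open import Data.Rational.Solver using (module +-*-Solver)
import Data.Rational.Unnormalised.Base as ℚᵘ
import Data.Rational.Unnormalised.Properties as ℚᵘ
open import Data.Sum.Base using (_⊎_; inj₁; inj₂)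
open import Data.Unit.Base using (⊤; tt)
open import Data.Vec.Base using (Vec; []; _∷_; lookup; tabulate; zipWith)
import Data.Vec.Properties as Vec
open import Function.Base using (_∘_)
open import Function.Bundles using (mk⇔)
open import Level using (0ℓ)
open import Relation.Binary.Definitions using (DecidableEquality; tri<; tri≈; tri>)
open import Relation.Binary.PropositionalEquality
open import Relation.Nullary.Decidable
  using (Dec; yes; no; does; dec-true; dec-false; does-⇔; _⊎-dec_)
open import Relation.Nullary.Negation using (¬_; contradiction)
open import Relation.Unary using (_∈_; Pred; Decidable)
open import Algebra.Properties.CommutativeMonoid.Sum ℚ.+-0-commutativeMonoid
  using ()
  renaming (sum to Σℚ; sum-cong-≗ to Σℚ-cong; ∑-distrib-+ to Σℚ-+; sum-replicate-zero to Σℚ-0)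
open import Algebra.Properties.CommutativeMonoid.Sum ℚ.*-1-commutativeMonoid
  using () renaming (sum to Πℚ; sum-cong-≗ to Πℚ-cong)
open import Algebra.Properties.CommutativeMonoid.Sum ℤ.*-1-commutativeMonoid
  using () renaming (sum to Πℤ; sum-cong-≗ to Πℤ-cong; ∑-distrib-+ to Πℤ-*)
open import Algebra.Properties.Semiring.Sum (CommutativeRing.semiring ℚ.+-*-commutativeRing)
  using () renaming (*-distribˡ-sum to *-distribˡ-Σℚ; *-distribʳ-sum to *-distribʳ-Σℚ)
open import Defs

-- The sampler can fail in two ways, and the bounds collected in `Valid` control both. A draw needs
-- natural parameters: k + T - t - S - 1 is the distance of the block from the lower bound t + 1 + S
-- - T for X(t+1), and k + 1 is positive, so every draw is well formed. This holds along the run,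
-- but a prescribed Y' may violate it; then the matrix entry vanishes together with the probability.
-- The lower bound for Y(t+1) is one higher than that for X(t+1). A coincidence lying on the old
-- bound therefore has to jump, and it does: there the first parameter of the distribution is 0,
-- which puts all mass on ξ = 0. The other outcomes, of weight zero, would leave the range, so the
-- invariants are stated with `Almost`. The proportionality is kept free of divisions: probability
-- times α equals path weight times β, with positive α and β chosen before z. The sign of the entry,
-- which the definition of the matrix tests, is read off from the same constants.

private
  variable
    A B : Set

  i+1-1≡i : ∀ i → i + 1ℤ - 1ℤ ≡ i
  i+1-1≡i = solve-∀

  i-1+1≡i : ∀ i → i - 1ℤ + 1ℤ ≡ i
  i-1+1≡i = solve-∀

  i+1-i≡1 : ∀ i → i + 1ℤ - i ≡ 1ℤ
  i+1-i≡1 = solve-∀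

  i-[i+1]≡-1 : ∀ i → i - (i + 1ℤ) ≡ -1ℤ
  i-[i+1]≡-1 = solve-∀

-- Rational arithmetic and the extended division

*-pos : ∀ {p q} → 0ℚ ℚ.< p → 0ℚ ℚ.< q → 0ℚ ℚ.< p * q
*-pos {p} {q} 0<p 0<q = ℚ.positive⁻¹ (p * q) {{ℚ.pos*pos⇒pos p {{ℚ.positive 0<p}} q {{ℚ.positive 0<q}}}}

*-≡0ˡ : ∀ {p} q → p ≡ 0ℚ → p * q ≡ 0ℚ
*-≡0ˡ q refl = ℚ.*-zeroˡ q

pos⇒≢0 : ∀ {p} → 0ℚ ℚ.< p → p ≢ 0ℚ
pos⇒≢0 0<p refl = ℚ.<-irrefl refl 0<p

*-cancelʳ-≢0 : ∀ {p q r} → r ≢ 0ℚ → p * r ≡ q * r → p ≡ q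
*-cancelʳ-≢0 {p} {q} {r} r≢0 pr≡qr = trans (unit p) (trans (cong (_* 1/r) pr≡qr) (sym (unit q)))
  where
  instance _ = ℚ.≢-nonZero r≢0
  1/r = ℚ.1/ r
  unit : ∀ s → s ≡ s * r * 1/r
  unit s = sym (trans (ℚ.*-assoc s r 1/r)
    (trans (cong (s *_) (ℚ.*-inverseʳ r)) (ℚ.*-identityʳ s)))

÷₀-*-cancel : ∀ p {q} → q ≢ 0ℚ → (p ÷₀ q) * q ≡ p
÷₀-*-cancel p {q} q≢0 with q ℚ.≟ 0ℚ
... | yes q≡0 = contradiction q≡0 q≢0
... | no  _   = trans (ℚ.*-assoc p _ q)
  (trans (cong (p *_) (ℚ.*-inverseˡ q {{ℚ.≢-nonZero q≢0}})) (ℚ.*-identityʳ p))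

÷₀-zeroʳ : ∀ p → p ÷₀ 0ℚ ≡ 0ℚ
÷₀-zeroʳ p = refl

÷₀-unique : ∀ {p q r} → q ≢ 0ℚ → r * q ≡ p → r ≡ p ÷₀ q
÷₀-unique q≢0 eq = *-cancelʳ-≢0 q≢0 (trans eq (sym (÷₀-*-cancel _ q≢0)))

-- `ι` reduces to lowest terms by a gcd that does not compute for a variable argument. Unnormalised
-- rationals avoid it, so multiplicativity and signs of `ι` are proved there and carried back.
toℚᵘ-ι : ∀ z → ℚ.toℚᵘ (ι z) ℚᵘ.≃ ℚᵘ.mkℚᵘ z 0
toℚᵘ-ι z = ℚ.toℚᵘ-fromℚᵘ (ℚᵘ.mkℚᵘ z 0)

ι-* : ∀ a b → ι (a *ᶻ b) ≡ ι a * ι b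
ι-* a b = ℚ.toℚᵘ-injective (begin
  ℚ.toℚᵘ (ι (a *ᶻ b))              ≈⟨ toℚᵘ-ι (a *ᶻ b) ⟩
  ℚᵘ.mkℚᵘ a 0 ℚᵘ.* ℚᵘ.mkℚᵘ b 0     ≈⟨ ℚᵘ.*-cong (toℚᵘ-ι a) (toℚᵘ-ι b) ⟨
  ℚ.toℚᵘ (ι a) ℚᵘ.* ℚ.toℚᵘ (ι b)   ≈⟨ ℚ.toℚᵘ-homo-* (ι a) (ι b) ⟨
  ℚ.toℚᵘ (ι a * ι b)               ∎)
  where open import Relation.Binary.Reasoning.Setoid ℚᵘ.≃-setoid

ι-pos : ∀ {z} → 0ℤ <ᶻ z → 0ℚ ℚ.< ι z
ι-pos {z} 0<z = ℚ.toℚᵘ-cancel-< (ℚᵘ.<-respʳ-≃ (ℚᵘ.≃-sym (toℚᵘ-ι z))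
  (ℚᵘ.*<* (subst (0ℤ <ᶻ_) (sym (ℤ.*-identityʳ z)) 0<z)))

-- Expectations

ind : {P : Set} → Dec P → ℚ
ind P? = if does P? then 1ℚ else 0ℚ

ind-yes : {P : Set} (P? : Dec P) → P → ind P? ≡ 1ℚ
ind-yes (yes _) _ = refl
ind-yes (no ¬p) p = contradiction p ¬p

ind-no : {P : Set} (P? : Dec P) → ¬ P → ind P? ≡ 0ℚ
ind-no (yes p) ¬p = contradiction p ¬p
ind-no (no _)  _  = refl

ind-⇔ : {P Q : Set} (P? : Dec P) (Q? : Dec Q) → (P → Q) → (Q → P) → ind P? ≡ ind Q?
ind-⇔ P? Q? P⇒Q Q⇒P = cong (if_then 1ℚ else 0ℚ) (does-⇔ (mk⇔ P⇒Q Q⇒P) P? Q?)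

E : Random A → (A → ℚ) → ℚ
E (return a)   f = f a
E (draw n μ κ) f = Σℚ λ k → μ k * E (κ k) f
E stuck        f = 0ℚ

Prob≡E : {P : Pred A 0ℓ} (m : Random A) (P? : Decidable P) → Prob m P? ≡ E m (ind ∘ P?)
Prob≡E (return a)   P? = refl
Prob≡E (draw n μ κ) P? = Σℚ-cong λ k → cong (μ k *_) (Prob≡E (κ k) P?)
Prob≡E stuck        P? = refl

E->>= : ∀ (m : Random A) (g : A → Random B) f → E (m >>= g) f ≡ E m (λ a → E (g a) f)
E->>= (return a)   g f = refl
E->>= (draw n μ κ) g f = Σℚ-cong λ k → cong (μ k *_) (E->>= (κ k) g f)
E->>= stuck        g f = refl

E-cong : ∀ (m : Random A) {f g} → f ≗ g → E m f ≡ E m g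
E-cong (return a)   f≗g = f≗g a
E-cong (draw n μ κ) f≗g = Σℚ-cong λ k → cong (μ k *_) (E-cong (κ k) f≗g)
E-cong stuck        f≗g = refl

E-0 : ∀ (m : Random A) → E m (λ _ → 0ℚ) ≡ 0ℚ
E-0 (return a)   = refl
E-0 (draw n μ κ) = trans
  (Σℚ-cong λ k → trans (cong (μ k *_) (E-0 (κ k))) (ℚ.*-zeroʳ (μ k)))
  (Σℚ-0 (suc n))
E-0 stuck        = refl

E-+ : ∀ (m : Random A) f g → E m (λ a → f a ℚ.+ g a) ≡ E m f ℚ.+ E m g
E-+ (return a)   f g = refl
E-+ (draw n μ κ) f g = trans
  (Σℚ-cong λ k → trans (cong (μ k *_) (E-+ (κ k) f g)) (ℚ.*-distribˡ-+ (μ k) (E (κ k) f) (E (κ k) g)))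
  (Σℚ-+ (λ k → μ k * E (κ k) f) (λ k → μ k * E (κ k) g))
E-+ stuck        f g = refl

E-*ʳ : ∀ (m : Random A) f c → E m (λ a → f a * c) ≡ E m f * c
E-*ʳ (return a)   f c = refl
E-*ʳ (draw n μ κ) f c = trans
  (Σℚ-cong λ k → trans (cong (μ k *_) (E-*ʳ (κ k) f c)) (sym (ℚ.*-assoc (μ k) (E (κ k) f) c)))
  (sym (*-distribʳ-Σℚ c (λ k → μ k * E (κ k) f)))
E-*ʳ stuck        f c = sym (ℚ.*-zeroˡ c)

-- P holds with probability one; in particular all distributions reached with
-- nonzero weight are normalised.
Almost : (A → Set) → Random A → Set
Almost P (return a)   = P a
Almost P (draw n μ κ) = Σℚ μ ≡ 1ℚ × (∀ k → μ k ≡ 0ℚ ⊎ Almost P (κ k))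
Almost P stuck        = ⊥

Almost->>= : {P : A → Set} {Q : B → Set} (m : Random A) {f : A → Random B} →
  Almost P m → (∀ a → P a → Almost Q (f a)) → Almost Q (m >>= f)
Almost->>= (return a)   Pa         Qf = Qf a Pa
Almost->>= (draw n μ κ) (Σμ , Pκ) Qf = Σμ , λ k → case (Pκ k) 
  where
  case : ∀ {k} → μ k ≡ 0ℚ ⊎ _ → μ k ≡ 0ℚ ⊎ _
  case     (inj₁ μ≡0) = inj₁ μ≡0
  case {k} (inj₂ h)   = inj₂ (Almost->>= (κ k) h Qf)

Almost-map : {P Q : A → Set} (m : Random A) → Almost P m → (∀ a → P a → Q a) → Almost Q m
Almost-map (return a)   Pa        P⇒Q = P⇒Q a Pa
Almost-map (draw n μ κ) (Σμ , Pκ) P⇒Q = Σμ , λ k → case (Pκ k)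
  where
  case : ∀ {k} → μ k ≡ 0ℚ ⊎ _ → μ k ≡ 0ℚ ⊎ _
  case     (inj₁ μ≡0) = inj₁ μ≡0
  case {k} (inj₂ h)   = inj₂ (Almost-map (κ k) h P⇒Q)

E-cong-Almost : {P : A → Set} (m : Random A) → Almost P m →
  ∀ {f g} → (∀ a → P a → f a ≡ g a) → E m f ≡ E m g
E-cong-Almost (return a)   Pa       f≗g = f≗g a Pa
E-cong-Almost {A} (draw n μ κ) (_ , Pκ) {f} {g} f≗g = Σℚ-cong λ k → case (Pκ k)
  where
  case : ∀ {k} → μ k ≡ 0ℚ ⊎ _ → μ k * E (κ k) f ≡ μ k * E (κ k) g
  case {k} (inj₁ μ≡0) = trans (*-≡0ˡ _ μ≡0) (sym (*-≡0ˡ _ μ≡0))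
  case {k} (inj₂ h) = cong (μ k *_) (E-cong-Almost (κ k) h f≗g)

E-1 : {P : A → Set} (m : Random A) → Almost P m → E m (λ _ → 1ℚ) ≡ 1ℚ
E-1 (return a)   _ = refl
E-1 (draw n μ κ) (Σμ , Pκ) = trans (Σℚ-cong λ k → case (Pκ k)) Σμ
  where
  case : ∀ {k} → μ k ≡ 0ℚ ⊎ _ → μ k * E (κ k) (λ _ → 1ℚ) ≡ μ k
  case {k} (inj₁ μ≡0) = trans (*-≡0ˡ _ μ≡0) (sym μ≡0)
  case {k} (inj₂ h)   = trans (cong (μ k *_) (E-1 (κ k) h)) (ℚ.*-identityʳ (μ k))

Almost⇒Prob≡1 : {P : Pred A 0ℓ} (P? : Decidable P) (m : Random A) → Almost P m → Prob m P? ≡ 1ℚ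
Almost⇒Prob≡1 P? m Pm = trans (Prob≡E m P?)
  (trans (E-cong-Almost m Pm λ a → ind-yes (P? a)) (E-1 m Pm))

-- Finite sums and point probabilities

sumˡ : (A → ℚ) → List A → ℚ
sumˡ f as = foldr ℚ._+_ 0ℚ (map f as)

sumˡ-cong : ∀ {f g : A → ℚ} (as : List A) → (∀ a → a ∈ˡ as → f a ≡ g a) → sumˡ f as ≡ sumˡ g as
sumˡ-cong []       f≗g = refl
sumˡ-cong (a ∷ as) f≗g = cong₂ ℚ._+_ (f≗g a (here refl)) (sumˡ-cong as λ b → f≗g b ∘ there)

sumˡ-*ʳ : ∀ (f : A → ℚ) c as → sumˡ (λ a → f a * c) as ≡ sumˡ f as * c
sumˡ-*ʳ f c []       = sym (ℚ.*-zeroˡ c)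
sumˡ-*ʳ f c (a ∷ as) = trans (cong (f a * c ℚ.+_) (sumˡ-*ʳ f c as))
  (sym (ℚ.*-distribʳ-+ c (f a) (sumˡ f as)))

E-sumˡ : ∀ (m : Random A) (f : B → A → ℚ) bs →
  E m (λ a → sumˡ (λ b → f b a) bs) ≡ sumˡ (λ b → E m (f b)) bs
E-sumˡ m f []       = E-0 m
E-sumˡ m f (b ∷ bs) = trans (E-+ m (f b) _) (cong (E m (f b) ℚ.+_) (E-sumˡ m f bs))

module _ (_≟_ : DecidableEquality A) where

  sumˡ-ind-∉ : ∀ a as → All (a ≢_) as → sumˡ (λ b → ind (a ≟ b)) as ≡ 0ℚ
  sumˡ-ind-∉ a []       []           = refl
  sumˡ-ind-∉ a (b ∷ bs) (a≢b ∷ a∉bs) =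
    cong₂ ℚ._+_ (ind-no (a ≟ b) a≢b) (sumˡ-ind-∉ a bs a∉bs)

  sumˡ-ind-∈ : ∀ {a as} → Unique as → a ∈ˡ as → sumˡ (λ b → ind (a ≟ b)) as ≡ 1ℚ
  sumˡ-ind-∈ {a} (a∉as ∷ _)  (here refl) =
    cong₂ ℚ._+_ (ind-yes (a ≟ a) refl) (sumˡ-ind-∉ a _ a∉as)
  sumˡ-ind-∈ {a} {b ∷ _} (b∉as ∷ u) (there a∈as) =
    cong₂ ℚ._+_ (ind-no (a ≟ b) (λ a≡b → All.lookup b∉as a∈as (sym a≡b))) (sumˡ-ind-∈ u a∈as)

  -- Expectation commutes with the finite sum, and the inner sum of indicators counts the outcome
  -- exactly once because the list has no repetitions. This supplies the normalisation of a step.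
  sumˡ-Prob : ∀ (m : Random A) {as} → Unique as → Almost (_∈ˡ as) m →
    sumˡ (λ a → Prob m (_≟ a)) as ≡ 1ℚ
  sumˡ-Prob m {as} u m∈as = trans
    (sumˡ-cong as λ a _ → Prob≡E m (_≟ a))
    (trans (sym (E-sumˡ m (λ b a → ind (a ≟ b)) as))
    (trans (E-cong-Almost m m∈as λ a → sumˡ-ind-∈ u) (E-1 m m∈as)))

  Prob-∉ : {P : A → Set} (m : Random A) → Almost P m → ∀ {a} → ¬ P a → Prob m (_≟ a) ≡ 0ℚ
  Prob-∉ m Pm {a} ¬Pa = trans (Prob≡E m (_≟ a))
    (trans (E-cong-Almost m Pm λ b Pb → ind-no (b ≟ a) λ { refl → ¬Pa Pb }) (E-0 m))

  -- The Markov property: the indicator of `a ∷ as` vanishes unless the first outcome is `a`, so the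
  -- continuation may be frozen at `a` and leaves the expectation as a constant.
  Prob-∷ : ∀ {n} (m : Random A) (r : A → Random (Vec A n)) a as →
    Prob (m >>= λ b → r b >>= λ bs → return (b ∷ bs)) (λ v → Vec.≡-dec _≟_ v (a ∷ as)) ≡
    Prob m (_≟ a) * Prob (r a) (λ v → Vec.≡-dec _≟_ v as)
  Prob-∷ m r a as = begin
    Prob (m >>= λ b → r b >>= λ bs → return (b ∷ bs)) (λ v → Vec.≡-dec _≟_ v (a ∷ as))
      ≡⟨ trans (Prob≡E (m >>= _) _) (E->>= m _ _) ⟩
    E m (λ b → E (r b >>= λ bs → return (b ∷ bs)) (λ v → ind (Vec.≡-dec _≟_ v (a ∷ as))))
      ≡⟨ E-cong m (λ b → trans (E->>= (r b) _ _) (split b)) ⟩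
    E m (λ b → ind (b ≟ a) * q)
      ≡⟨ E-*ʳ m _ q ⟩
    E m (λ b → ind (b ≟ a)) * q
      ≡⟨ cong₂ _*_ (Prob≡E m (_≟ a)) (Prob≡E (r a) _) ⟨
    Prob m (_≟ a) * Prob (r a) (λ v → Vec.≡-dec _≟_ v as) ∎
    where
    open ≡-Reasoning
    q = E (r a) (λ v → ind (Vec.≡-dec _≟_ v as))
    split : ∀ b → E (r b) (λ bs → ind (Vec.≡-dec _≟_ (b ∷ bs) (a ∷ as))) ≡ ind (b ≟ a) * q
    split b = case (b ≟ a)
      where
      case : Dec (b ≡ a) → _
      case (yes refl) = trans
        (E-cong (r a) λ bs → ind-⇔ (Vec.≡-dec _≟_ (a ∷ bs) (a ∷ as)) (Vec.≡-dec _≟_ bs as)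
          (λ { refl → refl }) (cong (a ∷_)))
        (sym (trans (cong (_* q) (ind-yes (a ≟ a) refl)) (ℚ.*-identityˡ q)))
      case (no b≢a) = trans
        (E-cong (r b) λ bs → ind-no (Vec.≡-dec _≟_ (b ∷ bs) (a ∷ as)) λ { refl → b≢a refl })
        (trans (E-0 (r b)) (sym (trans (cong (_* q) (ind-no (b ≟ a) b≢a)) (ℚ.*-zeroˡ q))))

-- Linear inequalities between integers

-- A linear inequality is proved by adding up the nonnegative gaps of the known
-- ones and matching the sum with its own gap by the ring solver.
gap-≤ : ∀ {i j} → i ≤ᶻ j → 0ℤ ≤ᶻ j - i
gap-≤ = ℤ.i≤j⇒0≤j-i

gap-< : ∀ {i j} → i <ᶻ j → 0ℤ ≤ᶻ j - i - 1ℤ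
gap-< {i} {j} i<j = subst (0ℤ ≤ᶻ_) (eq i j) (gap-≤ (ℤ.i<j⇒suc[i]≤j i<j))
  where
  eq : ∀ i j → j - (1ℤ + i) ≡ j - i - 1ℤ
  eq = solve-∀

≤-gap : ∀ {i j e} → 0ℤ ≤ᶻ e → e ≡ j - i → i ≤ᶻ j
≤-gap 0≤e refl = ℤ.0≤i-j⇒j≤i 0≤e

<-gap : ∀ {i j e} → 0ℤ ≤ᶻ e → e ≡ j - i - 1ℤ → i <ᶻ j
<-gap {i} {j} 0≤e refl = ℤ.suc[i]≤j⇒i<j (≤-gap 0≤e (eq i j))
  where
  eq : ∀ i j → j - i - 1ℤ ≡ j - (1ℤ + i)
  eq = solve-∀

infixl 6 _⊕_
_⊕_ : ∀ {i j} → 0ℤ ≤ᶻ i → 0ℤ ≤ᶻ j → 0ℤ ≤ᶻ i + j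
p ⊕ q = ℤ.+-mono-≤ p q

0≤+ : ∀ n → 0ℤ ≤ᶻ + n
0≤+ n = ℤ.+≤+ ℕ.z≤n

i<j⇒0<j-i : ∀ {i j} → i <ᶻ j → 0ℤ <ᶻ j - i
i<j⇒0<j-i {i} {j} i<j = <-gap (gap-< i<j) (eq (j - i))
  where
  eq : ∀ k → k - 1ℤ ≡ k - 0ℤ - 1ℤ
  eq = solve-∀

i<i+1 : ∀ i → i <ᶻ i + 1ℤ
i<i+1 i = <-gap ℤ.≤-refl (eq i)
  where
  eq : ∀ i → 0ℤ ≡ i + 1ℤ - i - 1ℤ
  eq = solve-∀

-- Finite products and signs

prodˡ : (A → ℚ) → List A → ℚ
prodˡ f as = foldr _*_ 1ℚ (map f as)

prodˡ-cong : ∀ {f g : A → ℚ} (as : List A) → (∀ a → a ∈ˡ as → f a ≡ g a) → prodˡ f as ≡ prodˡ g as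
prodˡ-cong []       f≗g = refl
prodˡ-cong (a ∷ as) f≗g = cong₂ _*_ (f≗g a (here refl)) (prodˡ-cong as λ b → f≗g b ∘ there)

prodˡ-++ : ∀ (f : A → ℚ) as bs → prodˡ f (as ++ bs) ≡ prodˡ f as * prodˡ f bs
prodˡ-++ f []       bs = sym (ℚ.*-identityˡ _)
prodˡ-++ f (a ∷ as) bs = trans (cong (f a *_) (prodˡ-++ f as bs)) (sym (ℚ.*-assoc (f a) _ _))

Σℚ-nonNeg : ∀ {n} (f : Fin n → ℚ) → (∀ i → 0ℚ ℚ.≤ f i) → 0ℚ ℚ.≤ Σℚ f
Σℚ-nonNeg {zero}  f 0≤f = ℚ.≤-refl
Σℚ-nonNeg {suc n} f 0≤f = ℚ.+-mono-≤ (0≤f Fin.zero) (Σℚ-nonNeg (f ∘ Fin.suc) (0≤f ∘ Fin.suc))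

Σℚ-pos : ∀ {n} (f : Fin (suc n) → ℚ) → 0ℚ ℚ.< f Fin.zero → (∀ i → 0ℚ ℚ.≤ f i) → 0ℚ ℚ.< Σℚ f
Σℚ-pos f 0<f₀ 0≤f = ℚ.+-mono-<-≤ 0<f₀ (Σℚ-nonNeg (f ∘ Fin.suc) (0≤f ∘ Fin.suc))

ι-nonNeg : ∀ n → 0ℚ ℚ.≤ ι (+ n)
ι-nonNeg zero    = ℚ.≤-refl
ι-nonNeg (suc n) = ℚ.<⇒≤ (ι-pos {+ suc n} (ℤ.+<+ (ℕ.s≤s ℕ.z≤n)))

-- Blocks

range : ℤ → ℕ → List ℤ
range k zero    = []
range k (suc l) = k ∷ range (k + 1ℤ) l

applyUpTo-range : ∀ {f : ℕ → ℤ} k n → (∀ j → f j ≡ k + + j) → applyUpTo f n ≡ range k n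
applyUpTo-range k zero    f≗ = refl
applyUpTo-range k (suc n) f≗ = cong₂ _∷_ (trans (f≗ 0) (ℤ.+-identityʳ k))
  (applyUpTo-range (k + 1ℤ) n λ j → trans (f≗ (suc j)) (sym (ℤ.+-assoc k 1ℤ (+ j))))

map-upTo-range : ∀ k n → map (λ j → k + + j) (upTo n) ≡ range k n
map-upTo-range k n = trans (List.map-upTo (λ j → k + + j) n) (applyUpTo-range k n λ _ → refl)

∈-range⁻ : ∀ {v} k l → v ∈ˡ range k l → k ≤ᶻ v × v <ᶻ k + + l
∈-range⁻ {v} k (suc l) (here refl) = ℤ.≤-refl , <-gap (0≤+ l) (eq k (+ l))
  where
  eq : ∀ k l → l ≡ k + (1ℤ + l) - k - 1ℤ
  eq = solve-∀
∈-range⁻ {v} k (suc l) (there v∈) with ∈-range⁻ (k + 1ℤ) l v∈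
... | k<v , v<k+l = ℤ.≤-trans (ℤ.<⇒≤ (i<i+1 k)) k<v , subst (v <ᶻ_) (ℤ.+-assoc k 1ℤ (+ l)) v<k+l

∈-range⁺ : ∀ {v} k l → k ≤ᶻ v → v <ᶻ k + + l → v ∈ˡ range k l
∈-range⁺ {v} k zero    k≤v v<k+l = contradiction v<k+l (ℤ.≤⇒≯ (subst (_≤ᶻ v) (sym (ℤ.+-identityʳ k)) k≤v))
∈-range⁺ {v} k (suc l) k≤v v<k+l with v ℤ.≟ k
... | yes v≡k = here v≡k
... | no  v≢k = there (∈-range⁺ (k + 1ℤ) l
  (subst (_≤ᶻ v) (ℤ.+-comm 1ℤ k) (ℤ.i<j⇒suc[i]≤j (ℤ.≤∧≢⇒< k≤v (v≢k ∘ sym))))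
  (subst (v <ᶻ_) (sym (ℤ.+-assoc k 1ℤ (+ l))) v<k+l))

points : List (ℤ × ℕ) → List ℤ
points []             = []
points ((k , l) ∷ bs) = range k l ++ points bs

points-blocks : ∀ cs → points (blocks cs) ≡ cs
points-blocks []       = refl
points-blocks (c ∷ cs) with blocks cs | points-blocks cs
... | []           | eq = cong (c ∷_) eq
... | (k , l) ∷ bs | eq with k ℤ.≟ c + 1ℤ
...   | yes refl = cong (c ∷_) eq
...   | no  _    = cong (c ∷_) eq

Ascending : ℤ → List ℤ → Set
Ascending m []       = ⊤
Ascending m (c ∷ cs) = m <ᶻ c × Ascending c cs

-- Consecutive blocks are separated by at least one missing integer.
Separated : (ℤ → Set) → ℤ → List (ℤ × ℕ) → Set
Separated P m []             = ⊤
Separated P m ((k , l) ∷ bs) = m <ᶻ k × P k × Separated P (k + + l) bs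

-- `blocks` opens a new block at c only if the next block starts above c but not at c + 1. So c + 1,
-- the first integer after the block (c , 1), lies strictly below the next block. Merging leaves the
-- end of the block unchanged.
Ascending⇒Separated : ∀ {P : ℤ → Set} m cs → All P cs → Ascending m cs → Separated P m (blocks cs)
Ascending⇒Separated m []       _          _            = tt
Ascending⇒Separated m (c ∷ cs) (Pc ∷ Pcs) (m<c , asc)
  with blocks cs | Ascending⇒Separated c cs Pcs asc
... | []           | _ = m<c , Pc , tt
... | (k , l) ∷ bs | c<k , Pk , sep with k ℤ.≟ c + 1ℤ
...   | yes refl = m<c , Pc , subst (λ i → Separated _ i bs) (ℤ.+-assoc c 1ℤ (+ l)) sep
...   | no  k≢   = m<c , Pc ,
  ℤ.≤∧≢⇒< (subst (_≤ᶻ k) (ℤ.+-comm 1ℤ c) (ℤ.i<j⇒suc[i]≤j c<k)) (k≢ ∘ sym) , Pk , sep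

Separated⇒< : ∀ {P m} bs → Separated P m bs → ∀ {v} → v ∈ˡ points bs → m <ᶻ v
Separated⇒< {m = m} ((k , l) ∷ bs) (m<k , _ , sep) v∈ with ∈-++⁻ (range k l) v∈
... | inj₁ v∈ = ℤ.<-≤-trans m<k (proj₁ (∈-range⁻ k l v∈))
... | inj₂ v∈ = ℤ.<-trans m<k (ℤ.≤-<-trans (ℤ.i≤i+j k (+ l)) (Separated⇒< bs sep v∈))

-- With P read as "stays", this is the exclusion rule: a particle jumping from v would land on one
-- that stays at v + 1. It is applied both to the sampled set and to the stayers prescribed by a
-- target configuration.
Downward : (ℤ → Set) → List ℤ → Set
Downward P cs = ∀ v → v ∈ˡ cs → v + 1ℤ ∈ˡ cs → P (v + 1ℤ) → P v

Downward-++⁻ˡ : ∀ {P : ℤ → Set} cs ds → Downward P (cs ++ ds) → Downward P cs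
Downward-++⁻ˡ cs ds down v v∈ v+1∈ = down v (∈-++⁺ˡ v∈) (∈-++⁺ˡ v+1∈)

Downward-++⁻ʳ : ∀ {P : ℤ → Set} cs {ds} → Downward P (cs ++ ds) → Downward P ds
Downward-++⁻ʳ cs down v v∈ v+1∈ = down v (∈-++⁺ʳ cs v∈) (∈-++⁺ʳ cs v+1∈)

-- The weights of `D`

rising-pos : ∀ a k → 1 ≤ a → 1 ≤ rising a k
rising-pos a zero    1≤a = ℕ.≤-refl
rising-pos a (suc k) 1≤a = ℕ.*-mono-≤ 1≤a (rising-pos (suc a) k (ℕ.s≤s ℕ.z≤n))

-- A global copy of the weight local to `D`; the two agree by computation.
weight : (a b n : ℕ) → Fin (suc n) → ℚ
weight a b n j = ι (+ (rising a (toℕ j) ℕ.* rising (b ℕ.+ toℕ j) (n ℕ.∸ toℕ j)))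

Σ-weight-pos : ∀ a b n → 0ℚ ℚ.< Σℚ (weight a (suc b) n)
Σ-weight-pos a b n = Σℚ-pos (weight a (suc b) n)
  (ι-pos {+ (1 ℕ.* rising (suc b ℕ.+ 0) n)}
    (ℤ.+<+ (ℕ.*-mono-≤ {1} {1} ℕ.≤-refl (rising-pos (suc b ℕ.+ 0) n (ℕ.s≤s ℕ.z≤n)))))
  (λ j → ι-nonNeg (rising a (toℕ j) ℕ.* rising (suc b ℕ.+ toℕ j) (n ℕ.∸ toℕ j)))

D-* : ∀ a b n k → D a (suc b) n k * Σℚ (weight a (suc b) n) ≡ weight a (suc b) n k
D-* a b n k = ÷₀-*-cancel (weight a (suc b) n k) (pos⇒≢0 (Σ-weight-pos a b n))

ΣD≡1 : ∀ a b n → Σℚ (D a (suc b) n) ≡ 1ℚ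
ΣD≡1 a b n = *-cancelʳ-≢0 (pos⇒≢0 (Σ-weight-pos a b n)) (begin
  Σℚ (D a (suc b) n) * W                ≡⟨ *-distribʳ-Σℚ W (D a (suc b) n) ⟩
  Σℚ (λ k → D a (suc b) n k * W)        ≡⟨ Σℚ-cong (D-* a b n) ⟩
  W                                     ≡⟨ ℚ.*-identityˡ W ⟨
  1ℚ * W                                ∎)
  where
  open ≡-Reasoning
  W = Σℚ (weight a (suc b) n)

-- The weight of a positive outcome contains the factor a = 0. A block with a = 0 starts on the
-- lower bound t + 1 + S - T, and this makes the whole block jump.
D-zero : ∀ b n k → D zero (suc b) n (Fin.suc k) ≡ 0ℚ
D-zero b n k = *-cancelʳ-≢0 (pos⇒≢0 (Σ-weight-pos 0 b n))
  (trans (D-* 0 b n (Fin.suc k)) (sym (ℚ.*-zeroˡ (Σℚ (weight 0 (suc b) n)))))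

match : Bool → Bool → ℚ
match true  true  = 1ℚ
match true  false = 0ℚ
match false true  = 0ℚ
match false false = 1ℚ

-- The product of the indicators [c stays ⇔ f c] over a (k , l)-block of which
-- the ξ smallest points stay.
blockMatch : (ℤ → Bool) → ℕ → ℤ → ℕ → ℚ
blockMatch f ξ       k zero    = 1ℚ
blockMatch f zero    k (suc l) = match false (f k) * blockMatch f zero (k + 1ℤ) l
blockMatch f (suc ξ) k (suc l) = match true  (f k) * blockMatch f ξ    (k + 1ℤ) l

prodˡ-match-range : ∀ (f s : ℤ → Bool) ξ k l → (∀ c → c ∈ˡ range k l → s c ≡ does (c ℤ.<? k + + ξ)) →
  prodˡ (λ c → match (s c) (f c)) (range k l) ≡ blockMatch f ξ k l
prodˡ-match-range f s ξ       k zero    s≗ = refl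
prodˡ-match-range f s zero    k (suc l) s≗ = cong₂ (λ b p → match b (f k) * p)
  (trans (s≗ k (here refl)) (dec-false (k ℤ.<? k + 0ℤ) (ℤ.<-irrefl (sym (ℤ.+-identityʳ k)))))
  (prodˡ-match-range f s zero (k + 1ℤ) l λ c c∈ →
    let k<c = ℤ.<-≤-trans (i<i+1 k) (proj₁ (∈-range⁻ (k + 1ℤ) l c∈)) in
    trans (s≗ c (there c∈)) (trans
      (dec-false (c ℤ.<? k + 0ℤ) (ℤ.<-asym (subst (_<ᶻ c) (sym (ℤ.+-identityʳ k)) k<c)))
      (sym (dec-false (c ℤ.<? k + 1ℤ + 0ℤ) (ℤ.≤⇒≯
        (subst (_≤ᶻ c) (sym (ℤ.+-identityʳ (k + 1ℤ))) (proj₁ (∈-range⁻ (k + 1ℤ) l c∈))))))))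
prodˡ-match-range f s (suc ξ) k (suc l) s≗ = cong₂ (λ b p → match b (f k) * p)
  (trans (s≗ k (here refl)) (dec-true (k ℤ.<? k + + suc ξ)
    (proj₂ (∈-range⁻ {k} k (suc ξ) (here refl)))))
  (prodˡ-match-range f s ξ (k + 1ℤ) l λ c c∈ → trans (s≗ c (there c∈))
    (cong (λ i → does (c ℤ.<? i)) (sym (ℤ.+-assoc k 1ℤ (+ ξ)))))

module _ (N T S t : ℕ) where

  -- The distance of c from the lower bound t + 1 + S - T for X(t+1). At the start of a block it is
  -- the first parameter of `D`; being positive means that c also meets the bound t + 2 + S - T for
  -- Y(t+1).
  shift : ℤ → ℤ
  shift c = c + + T - + t - + S - 1ℤ

  shift-suc : ∀ c → shift (c + 1ℤ) ≡ 1ℤ + shift c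
  shift-suc c = eq c (+ T) (+ t) (+ S)
    where
    eq : ∀ c T t S → c + 1ℤ + T - t - S - 1ℤ ≡ 1ℤ + (c + T - t - S - 1ℤ)
    eq = solve-∀

  shift-mono : ∀ {c d} → c <ᶻ d → shift c <ᶻ shift d
  shift-mono {c} {d} c<d = <-gap (gap-< c<d) (eq c d (+ T) (+ t) (+ S))
    where
    eq : ∀ c d T t S → d - c - 1ℤ ≡ d + T - t - S - 1ℤ - (c + T - t - S - 1ℤ) - 1ℤ
    eq = solve-∀

  jumpOrStay : ℤ → Bool → ℚ
  jumpOrStay c stays = ι (if stays then shift c else c + 1ℤ)

  prodˡ-jumps : ∀ f k b l → k + 1ℤ ≡ + b → All (λ c → f c ≡ false) (range k l) →
    prodˡ (λ c → jumpOrStay c (f c)) (range k l) ≡ ι (+ rising b l) × blockMatch f 0 k l ≡ 1ℚ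
  prodˡ-jumps f k b zero    k+1≡b _ = refl , refl
  prodˡ-jumps f k b (suc l) k+1≡b (¬fk ∷ ¬f)
    with ih₁ , ih₂ ← prodˡ-jumps f (k + 1ℤ) (suc b) l (trans (ℤ.+-comm (k + 1ℤ) 1ℤ) (cong (ℤ._+_ 1ℤ) k+1≡b)) ¬f
    = (begin
      jumpOrStay k (f k) * _       ≡⟨ cong₂ _*_ (trans (cong (jumpOrStay k) ¬fk) (cong ι k+1≡b)) ih₁ ⟩
      ι (+ b) * ι (+ rising (suc b) l)  ≡⟨ ι-* (+ b) (+ rising (suc b) l) ⟨
      ι (+ b *ᶻ + rising (suc b) l)     ≡⟨ cong ι (ℤ.pos-* b (rising (suc b) l)) ⟨
      ι (+ rising b (suc l))            ∎)
    , cong₂ (λ s p → match false s * p) ¬fk ih₂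
    where open ≡-Reasoning

  jumps-after-jump : ∀ (f : ℤ → Bool) k l → Downward (λ c → f c ≡ true) (range k (suc l)) → f k ≡ false →
    All (λ c → f c ≡ false) (range k (suc l))
  jumps-after-jump f k zero    down ¬fk = ¬fk ∷ []
  jumps-after-jump f k (suc l) down ¬fk = ¬fk ∷ jumps-after-jump f (k + 1ℤ) l
    (Downward-++⁻ʳ (k ∷ []) down) (¬fk+1 (f (k + 1ℤ)) refl)
    where
    ¬fk+1 : ∀ b → f (k + 1ℤ) ≡ b → f (k + 1ℤ) ≡ false
    ¬fk+1 false eq = eq
    ¬fk+1 true  eq with () ← trans (sym ¬fk) (down k (here refl) (there (here refl)) eq)

  -- Removing the smallest point of a block, when it stays, splits a off the first rising factorial
  -- and raises both parameters by one, just as k becomes k + 1.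
  weight-suc : ∀ a b l (j : Fin (suc l)) →
    weight a b (suc l) (Fin.suc j) ≡ ι (+ a) * weight (suc a) (suc b) l j
  weight-suc a b l j = begin
    ι (+ (a ℕ.* r ℕ.* rising (b ℕ.+ suc i) (l ℕ.∸ i)))
      ≡⟨ cong (ι ∘ +_) (trans (ℕ.*-assoc a r _) (cong (λ d → a ℕ.* (r ℕ.* rising d (l ℕ.∸ i))) (ℕ.+-suc b i))) ⟩
    ι (+ (a ℕ.* (r ℕ.* q)))
      ≡⟨ cong ι (ℤ.pos-* a (r ℕ.* q)) ⟩
    ι (+ a *ᶻ + (r ℕ.* q))
      ≡⟨ ι-* (+ a) (+ (r ℕ.* q)) ⟩
    ι (+ a) * ι (+ (r ℕ.* q)) ∎
    where
    open ≡-Reasoning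
    i = toℕ j
    r = rising (suc a) i
    q = rising (suc b ℕ.+ i) (l ℕ.∸ i)

  -- Only the ξ equal to the prescribed number of stayers survives. If the first point stays, the
  -- term ξ = 0 vanishes and `weight-suc` reduces to the rest of the block. If it jumps, `Downward`
  -- makes the whole block jump, and the term ξ = 0 alone remains, with weight (b)_l.
  Σ-weight-blockMatch : ∀ f k a b l → shift k ≡ + a → k + 1ℤ ≡ + b →
    Downward (λ c → f c ≡ true) (range k l) →
    Σℚ (λ ξ → weight a b l ξ * blockMatch f (toℕ ξ) k l) ≡
    prodˡ (λ c → jumpOrStay c (f c)) (range k l)
  Σ-weight-blockMatch f k a b zero    _     _     _    = refl
  Σ-weight-blockMatch f k a b (suc l) k≡a k+1≡b down = case (f k) refl
    where
    open ≡-Reasoning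
    W = weight a b (suc l)
    goal : Set
    goal = Σℚ (λ ξ → W ξ * blockMatch f (toℕ ξ) k (suc l)) ≡
           prodˡ (λ c → jumpOrStay c (f c)) (range k (suc l))
    case : ∀ s → f k ≡ s → goal
    case true fk = begin
      W Fin.zero * (match false (f k) * m Fin.zero) ℚ.+
        Σℚ (λ ξ → W (Fin.suc ξ) * (match true (f k) * m ξ))
        ≡⟨ cong₂ ℚ._+_
             (trans (cong (λ s → W Fin.zero * (match false s * m Fin.zero)) fk)
               (trans (cong (W Fin.zero *_) (ℚ.*-zeroˡ (m Fin.zero))) (ℚ.*-zeroʳ (W Fin.zero))))
             (Σℚ-cong λ ξ → trans
               (cong₂ (λ w s → w * (match true s * m ξ)) (weight-suc a b l ξ) fk)
               (trans (cong (ι (+ a) * W′ ξ *_) (ℚ.*-identityˡ (m ξ))) (ℚ.*-assoc (ι (+ a)) (W′ ξ) (m ξ)))) ⟩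
      0ℚ ℚ.+ Σℚ (λ ξ → ι (+ a) * (W′ ξ * m ξ))
        ≡⟨ ℚ.+-identityˡ _ ⟩
      Σℚ (λ ξ → ι (+ a) * (W′ ξ * m ξ))
        ≡⟨ *-distribˡ-Σℚ (ι (+ a)) (λ ξ → W′ ξ * m ξ) ⟨
      ι (+ a) * Σℚ (λ ξ → W′ ξ * m ξ)
        ≡⟨ cong₂ _*_ (sym (trans (cong (jumpOrStay k) fk) (cong ι k≡a)))
             (Σ-weight-blockMatch f (k + 1ℤ) (suc a) (suc b) l
               (trans (shift-suc k) (cong (ℤ._+_ 1ℤ) k≡a))
               (trans (ℤ.+-comm (k + 1ℤ) 1ℤ) (cong (ℤ._+_ 1ℤ) k+1≡b))
               (Downward-++⁻ʳ (k ∷ []) down)) ⟩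
      jumpOrStay k (f k) * prodˡ (λ c → jumpOrStay c (f c)) (range (k + 1ℤ) l) ∎
      where
      W′ = weight (suc a) (suc b) l
      m : Fin (suc l) → ℚ
      m ξ = blockMatch f (toℕ ξ) (k + 1ℤ) l
    case false ¬fk with prod , match≡1 ← prodˡ-jumps f k b (suc l) k+1≡b (jumps-after-jump f k l down ¬fk) = begin
      W Fin.zero * blockMatch f 0 k (suc l) ℚ.+
        Σℚ (λ ξ → W (Fin.suc ξ) * (match true (f k) * m ξ))
        ≡⟨ cong₂ ℚ._+_
             (trans (cong (W Fin.zero *_) match≡1) (ℚ.*-identityʳ (W Fin.zero)))
             (trans (Σℚ-cong λ ξ → trans (cong (λ s → W (Fin.suc ξ) * (match true s * m ξ)) ¬fk)
               (trans (cong (W (Fin.suc ξ) *_) (ℚ.*-zeroˡ (m ξ))) (ℚ.*-zeroʳ (W (Fin.suc ξ)))))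
               (Σℚ-0 (suc l))) ⟩
      W Fin.zero ℚ.+ 0ℚ
        ≡⟨ ℚ.+-identityʳ (W Fin.zero) ⟩
      W Fin.zero
        ≡⟨ cong (ι ∘ +_) (trans (ℕ.*-identityˡ _) (cong (λ d → rising d (suc l)) (ℕ.+-identityʳ b))) ⟩
      ι (+ rising b (suc l))
        ≡⟨ prod ⟨
      prodˡ (λ c → jumpOrStay c (f c)) (range k (suc l)) ∎
      where
      m : Fin (suc l) → ℚ
      m ξ = blockMatch f (toℕ ξ) (k + 1ℤ) l

+1-injective : ∀ {i j} → i + 1ℤ ≡ j + 1ℤ → i ≡ j
+1-injective {i} {j} eq = trans (sym (i+1-1≡i i)) (trans (cong (_- 1ℤ) eq) (i+1-1≡i j))

<⇒+1≤ : ∀ {i j} → i <ᶻ j → i + 1ℤ ≤ᶻ j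
<⇒+1≤ {i} i<j = subst (_≤ᶻ _) (ℤ.+-comm 1ℤ i) (ℤ.i<j⇒suc[i]≤j i<j)

-- Law of the staying points

module _ (N T S t : ℕ) where

  -- Equations instead of inequalities, because `sampleD` computes only on arguments of the literal
  -- form `+ a` and `+ b`.
  Admissible : ℤ → Set
  Admissible c = (∃ λ a → shift N T S t c ≡ + a) × (∃ λ b → c ≡ + b)

  sampleD-Admissible : ∀ {k a b} l → shift N T S t k ≡ + a → k ≡ + b →
    sampleD (shift N T S t k) (k + 1ℤ) l ≡ draw l (D a (suc b) l) return
  sampleD-Admissible {b = b} l k≡a k≡b = cong₂ (λ i j → sampleD i j l) k≡a
    (trans (cong (_+ 1ℤ) k≡b) (cong +_ (ℕ.+-comm b 1)))

  Almost-D : ∀ a b n → Almost (λ ξ → a ≡ 0 → toℕ ξ ≡ 0) (draw n (D a (suc b) n) return)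
  Almost-D a b n = ΣD≡1 a b n , support a
    where
    support : ∀ a ξ → D a (suc b) n ξ ≡ 0ℚ ⊎ (a ≡ 0 → toℕ ξ ≡ 0)
    support zero    Fin.zero    = inj₂ λ _ → refl
    support zero    (Fin.suc ξ) = inj₁ (D-zero b n ξ)
    support (suc a) ξ           = inj₂ λ ()

  -- What the sampled set must satisfy for the step to succeed: `shift-pos` puts the stayers on or
  -- above the raised lower bound, `downward` prevents collisions, and `⊆-points` keeps the samples
  -- of different blocks from interfering.
  record Stays (bs : List (ℤ × ℕ)) (stay : List ℤ) : Set where
    field
      ⊆-points : ∀ {v} → v ∈ˡ stay → v ∈ˡ points bs
      shift-pos : ∀ {v} → v ∈ˡ stay → 0ℤ <ᶻ shift N T S t v
      downward : Downward (_∈ˡ stay) (points bs)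

  Stays-∷ : ∀ {m k l a bs stay} (ξ : Fin (suc l)) → shift N T S t k ≡ + a → (a ≡ 0 → toℕ ξ ≡ 0) →
    Separated Admissible m ((k , l) ∷ bs) → Stays bs stay →
    Stays ((k , l) ∷ bs) (range k (toℕ ξ) ++ stay)
  Stays-∷ {m} {k} {l} {a} {bs} {stay} ξ k≡a a≡0⇒ξ≡0 (m<k , _ , sep) stays = record
    { ⊆-points = ⊆-points′ ; shift-pos = shift-pos′ ; downward = downward′ }
    where
    open Stays stays
    ξ≤l = ℤ.+≤+ (Fin.toℕ≤pred[n] ξ)

    ⊆-points′ : ∀ {v} → v ∈ˡ range k (toℕ ξ) ++ stay → v ∈ˡ points ((k , l) ∷ bs)
    ⊆-points′ v∈ with ∈-++⁻ (range k (toℕ ξ)) v∈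
    ... | inj₁ v∈ = let k≤v , v<k+ξ = ∈-range⁻ k (toℕ ξ) v∈ in
      ∈-++⁺ˡ (∈-range⁺ k l k≤v (ℤ.<-≤-trans v<k+ξ (ℤ.+-monoʳ-≤ k ξ≤l)))
    ... | inj₂ v∈ = ∈-++⁺ʳ (range k l) (⊆-points v∈)

    0<a : ∀ {v} a → shift N T S t k ≡ + a → (a ≡ 0 → toℕ ξ ≡ 0) → v ∈ˡ range k (toℕ ξ) → 0ℤ <ᶻ + a
    0<a zero    _ ξ≡0 v∈ with toℕ ξ | ξ≡0 refl
    0<a zero    _ ξ≡0 () | _ | refl
    0<a (suc a) _ _   _  = ℤ.+<+ (ℕ.s≤s ℕ.z≤n)

    shift-pos′ : ∀ {v} → v ∈ˡ range k (toℕ ξ) ++ stay → 0ℤ <ᶻ shift N T S t v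
    shift-pos′ {v} v∈ with ∈-++⁻ (range k (toℕ ξ)) v∈
    ... | inj₂ v∈ = shift-pos v∈
    -- Only the smallest point k can have shift 0, and then ξ = 0, so no point of the block stays.
    -- Any later point has a strictly larger shift.
    ... | inj₁ v∈ with k ℤ.≟ v
    ...   | yes refl = subst (0ℤ <ᶻ_) (sym k≡a) (0<a a k≡a a≡0⇒ξ≡0 v∈)
    ...   | no  k≢v  = ℤ.≤-<-trans (subst (0ℤ ≤ᶻ_) (sym k≡a) (0≤+ a))
      (shift-mono N T S t (ℤ.≤∧≢⇒< (proj₁ (∈-range⁻ k (toℕ ξ) v∈)) k≢v))

    downward′ : Downward (_∈ˡ range k (toℕ ξ) ++ stay) (points ((k , l) ∷ bs))
    downward′ v v∈ v+1∈ v+1∈stay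
      with ∈-++⁻ (range k l) v∈ | ∈-++⁻ (range k (toℕ ξ)) v+1∈stay
    ... | inj₁ v∈ | inj₁ v+1∈ = ∈-++⁺ˡ (∈-range⁺ k (toℕ ξ) (proj₁ (∈-range⁻ k l v∈))
      (ℤ.<-trans (i<i+1 v) (proj₂ (∈-range⁻ k (toℕ ξ) v+1∈))))
    -- Maximality of the blocks enters here. If the next block could begin at v + 1, its points
    -- might stay while v jumps onto them.
    ... | inj₁ v∈ | inj₂ v+1∈ = contradiction (Separated⇒< bs sep (⊆-points v+1∈))
      (ℤ.≤⇒≯ (<⇒+1≤ (proj₂ (∈-range⁻ k l v∈))))
    ... | inj₂ v∈ | inj₁ v+1∈ = contradiction
      (ℤ.<-trans (Separated⇒< bs sep v∈) (ℤ.<-≤-trans (ℤ.<-trans (i<i+1 v)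
        (proj₂ (∈-range⁻ k (toℕ ξ) v+1∈))) (ℤ.+-monoʳ-≤ k ξ≤l))) (ℤ.<-irrefl refl)
    ... | inj₂ v∈ | inj₂ v+1∈ = ∈-++⁺ʳ (range k (toℕ ξ)) (downward v v∈ (⊆-points v+1∈) v+1∈)

  Almost-stayingPoints : ∀ {m} bs → Separated Admissible m bs →
    Almost (Stays bs) (stayingPoints N T S t bs)
  Almost-stayingPoints [] _ = record { ⊆-points = λ () ; shift-pos = λ () ; downward = λ _ () }
  Almost-stayingPoints ((k , l) ∷ bs) sep@(_ , ((a , k≡a) , (b , k≡b)) , sep′) =
    Almost->>= (sampleD (shift N T S t k) (k + 1ℤ) l)
      (subst (Almost _) (sym (sampleD-Admissible l k≡a k≡b)) (Almost-D a b l))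
      λ ξ ξ≡0 → Almost->>= (stayingPoints N T S t bs) (Almost-stayingPoints bs sep′)
      λ stay stays → subst (λ r → Stays ((k , l) ∷ bs) (r ++ stay)) (sym (map-upTo-range k (toℕ ξ)))
        (Stays-∷ ξ k≡a ξ≡0 sep stays)

  E-stayingPoints-∷ : ∀ {k a b} l bs (h : List ℤ → ℚ) → shift N T S t k ≡ + a → k ≡ + b →
    E (stayingPoints N T S t ((k , l) ∷ bs)) h ≡
    Σℚ (λ ξ → D a (suc b) l ξ * E (stayingPoints N T S t bs) (λ stay → h (range k (toℕ ξ) ++ stay)))
  E-stayingPoints-∷ {k} {a} {b} l bs h k≡a k≡b = begin
    E (sampleD (shift N T S t k) (k + 1ℤ) l >>= rest) h
      ≡⟨ E->>= (sampleD (shift N T S t k) (k + 1ℤ) l) rest h ⟩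
    E (sampleD (shift N T S t k) (k + 1ℤ) l) (λ ξ → E (rest ξ) h)
      ≡⟨ cong (λ m → E m (λ ξ → E (rest ξ) h)) (sampleD-Admissible l k≡a k≡b) ⟩
    Σℚ (λ ξ → D a (suc b) l ξ * E (rest ξ) h)
      ≡⟨ (Σℚ-cong λ ξ → cong (D a (suc b) l ξ *_) (trans
           (E->>= (stayingPoints N T S t bs)
             (λ stay → return (map (λ j → k + + j) (upTo (toℕ ξ)) ++ stay)) h)
           (E-cong (stayingPoints N T S t bs) λ stay →
             cong (λ r → h (r ++ stay)) (map-upTo-range k (toℕ ξ))))) ⟩
    Σℚ (λ ξ → D a (suc b) l ξ * E (stayingPoints N T S t bs) (λ stay → h (range k (toℕ ξ) ++ stay))) ∎
    where
    open ≡-Reasoning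
    rest : Fin (suc l) → Random (List ℤ)
    rest ξ = stayingPoints N T S t bs >>= λ stay → return (map (λ j → k + + j) (upTo (toℕ ξ)) ++ stay)

  stayMatch : (ℤ → Bool) → List ℤ → List ℤ → ℚ
  stayMatch f cs stay = prodˡ (λ c → match (does (c ∈? stay)) (f c)) cs

  -- On the first block membership in the sampled set is the test c < k + ξ, since all other stayers
  -- lie beyond the block; on the later blocks the stayers of the first are invisible. The indicator
  -- therefore factors, which turns independence of the draws into a product.
  stayMatch-∷ : ∀ {P m k l bs stay} f (ξ : Fin (suc l)) → Separated P m ((k , l) ∷ bs) → Stays bs stay →
    stayMatch f (points ((k , l) ∷ bs)) (range k (toℕ ξ) ++ stay) ≡
    blockMatch f (toℕ ξ) k l * stayMatch f (points bs) stay
  stayMatch-∷ {k = k} {l} {bs} {stay} f ξ (_ , _ , sep) stays = trans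
    (prodˡ-++ (λ c → match (s c) (f c)) (range k l) (points bs))
    (cong₂ _*_
      (prodˡ-match-range f s (toℕ ξ) k l λ c c∈ → does-⇔ (mk⇔
        (λ c∈++ → case c∈ (∈-++⁻ (range k (toℕ ξ)) c∈++))
        (λ c<k+ξ → ∈-++⁺ˡ (∈-range⁺ k (toℕ ξ) (proj₁ (∈-range⁻ k l c∈)) c<k+ξ)))
        (c ∈? range k (toℕ ξ) ++ stay) (c ℤ.<? k + + toℕ ξ))
      (prodˡ-cong (points bs) λ c c∈ → cong (λ b → match b (f c))
        (does-⇔
          (mk⇔ (λ c∈++ → case′ c∈ (∈-++⁻ (range k (toℕ ξ)) c∈++)) (∈-++⁺ʳ (range k (toℕ ξ))))
          (c ∈? range k (toℕ ξ) ++ stay) (c ∈? stay))))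
    where
    open Stays stays
    s : ℤ → Bool
    s c = does (c ∈? range k (toℕ ξ) ++ stay)
    case : ∀ {c} → c ∈ˡ range k l → c ∈ˡ range k (toℕ ξ) ⊎ c ∈ˡ stay → c <ᶻ k + + toℕ ξ
    case c∈ (inj₁ c∈ξ) = proj₂ (∈-range⁻ k (toℕ ξ) c∈ξ)
    case c∈ (inj₂ c∈stay) = contradiction
      (ℤ.<-trans (Separated⇒< bs sep (⊆-points c∈stay)) (proj₂ (∈-range⁻ k l c∈))) (ℤ.<-irrefl refl)
    case′ : ∀ {c} → c ∈ˡ points bs → c ∈ˡ range k (toℕ ξ) ⊎ c ∈ˡ stay → c ∈ˡ stay
    case′ c∈ (inj₂ c∈stay) = c∈stay
    case′ c∈ (inj₁ c∈ξ) = contradiction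
      (ℤ.<-trans (Separated⇒< bs sep c∈) (ℤ.<-≤-trans (proj₂ (∈-range⁻ k (toℕ ξ) c∈ξ))
        (ℤ.+-monoʳ-≤ k (ℤ.+≤+ (Fin.toℕ≤pred[n] ξ))))) (ℤ.<-irrefl refl)

  -- Z is the product of the normalising sums of the block distributions. It is chosen before f, so
  -- that one constant serves all target configurations; multiplying by it turns each `D` into its
  -- bare weight.
  E-stayMatch : ∀ {m} bs → Separated Admissible m bs → ∃ λ Z → 0ℚ ℚ.< Z ×
    (∀ f → Downward (λ c → f c ≡ true) (points bs) →
      E (stayingPoints N T S t bs) (stayMatch f (points bs)) * Z ≡
      prodˡ (λ c → jumpOrStay N T S t c (f c)) (points bs))
  E-stayMatch [] _ = 1ℚ , ℚ.positive⁻¹ 1ℚ , λ _ _ → refl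
  E-stayMatch ((k , l) ∷ bs) sep@(_ , ((a , k≡a) , (b , k≡b)) , sep′)
    with Z , 0<Z , eq ← E-stayMatch bs sep′
    = W * Z , *-pos (Σ-weight-pos a b l) 0<Z , λ f down → begin
      E (stayingPoints N T S t ((k , l) ∷ bs)) (stayMatch f (points ((k , l) ∷ bs))) * (W * Z)
        ≡⟨ cong (_* (W * Z)) (E-stayingPoints-∷ l bs _ k≡a k≡b) ⟩
      Σℚ (λ ξ → D a (suc b) l ξ * E (stayingPoints N T S t bs)
        (λ stay → stayMatch f (points ((k , l) ∷ bs)) (range k (toℕ ξ) ++ stay))) * (W * Z)
        ≡⟨ cong (_* (W * Z)) (Σℚ-cong λ ξ → cong (D a (suc b) l ξ *_) (inner f ξ)) ⟩
      Σℚ (λ ξ → D a (suc b) l ξ * (blockMatch f (toℕ ξ) k l * e f)) * (W * Z)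
        ≡⟨ *-distribʳ-Σℚ (W * Z) (λ ξ → D a (suc b) l ξ * (blockMatch f (toℕ ξ) k l * e f)) ⟩
      Σℚ (λ ξ → D a (suc b) l ξ * (blockMatch f (toℕ ξ) k l * e f) * (W * Z))
        ≡⟨ (Σℚ-cong λ ξ → trans (rearrange (D a (suc b) l ξ) (blockMatch f (toℕ ξ) k l) (e f) W Z)
             (cong (λ w → w * blockMatch f (toℕ ξ) k l * (e f * Z)) (D-* a b l ξ))) ⟩
      Σℚ (λ ξ → weight a (suc b) l ξ * blockMatch f (toℕ ξ) k l * (e f * Z))
        ≡⟨ *-distribʳ-Σℚ (e f * Z) (λ ξ → weight a (suc b) l ξ * blockMatch f (toℕ ξ) k l) ⟨
      Σℚ (λ ξ → weight a (suc b) l ξ * blockMatch f (toℕ ξ) k l) * (e f * Z)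
        ≡⟨ cong₂ _*_
             (Σ-weight-blockMatch N T S t f k a (suc b) l k≡a
               (trans (cong (_+ 1ℤ) k≡b) (cong +_ (ℕ.+-comm b 1)))
               (Downward-++⁻ˡ (range k l) (points bs) down))
             (eq f (Downward-++⁻ʳ (range k l) down)) ⟩
      prodˡ (λ c → jumpOrStay N T S t c (f c)) (range k l) *
        prodˡ (λ c → jumpOrStay N T S t c (f c)) (points bs)
        ≡⟨ prodˡ-++ (λ c → jumpOrStay N T S t c (f c)) (range k l) (points bs) ⟨
      prodˡ (λ c → jumpOrStay N T S t c (f c)) (points ((k , l) ∷ bs)) ∎
    where
    open ≡-Reasoning
    W = Σℚ (weight a (suc b) l)
    e : (ℤ → Bool) → ℚ
    e f = E (stayingPoints N T S t bs) (stayMatch f (points bs))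
    inner : ∀ f ξ → E (stayingPoints N T S t bs)
        (λ stay → stayMatch f (points ((k , l) ∷ bs)) (range k (toℕ ξ) ++ stay)) ≡
      blockMatch f (toℕ ξ) k l * e f
    inner f ξ = trans
      (E-cong-Almost (stayingPoints N T S t bs) (Almost-stayingPoints bs sep′) λ stay stays →
        trans (stayMatch-∷ f ξ sep stays) (ℚ.*-comm (blockMatch f (toℕ ξ) k l) _))
      (trans (E-*ʳ (stayingPoints N T S t bs) (stayMatch f (points bs)) (blockMatch f (toℕ ξ) k l))
        (ℚ.*-comm _ (blockMatch f (toℕ ξ) k l)))
    rearrange : ∀ d m e w z → d * (m * e) * (w * z) ≡ d * w * m * (e * z)
    rearrange = solve 5 (λ d m e w z → d :* (m :* e) :* (w :* z) := d :* w :* m :* (e :* z)) refl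
      where open +-*-Solver

-- One step of the algorithm

Near : ℤ → ℤ → Set
Near y x = x - y ≡ 1ℤ ⊎ x - y ≡ -1ℤ ⊎ x ≡ y

data Move (stay : List ℤ) : ℤ → ℤ → ℤ → Set where
  rise : ∀ {y} → Move stay y (y + 1ℤ) (y + 1ℤ)
  fall : ∀ {x} → Move stay (x + 1ℤ) x (x + 1ℤ)
  rest : ∀ {x} → x ∈ˡ stay → Move stay x x x
  jump : ∀ {x} → x ∉ˡ stay → Move stay x x (x + 1ℤ)

-- `newPoint` with its last test dropped: for near pairs that test succeeds whenever it is reached.
-- Given the staying points, the update of near configurations is thus a pure function.
point : List ℤ → ℤ → ℤ → ℤ
point stay y x =
  if does (x - y ℤ.≟ 1ℤ) then x else
  if does (x - y ℤ.≟ -1ℤ) then y else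
  if does (x ∈? stay) then x else x + 1ℤ

i-j≡k⇒i≡j+k : ∀ {i j k} → i - j ≡ k → i ≡ j + k
i-j≡k⇒i≡j+k {i} {j} refl = eq i j
  where
  eq : ∀ i j → i ≡ j + (i - j)
  eq = solve-∀

i-j≡-1⇒j≡i+1 : ∀ {i j} → i - j ≡ -1ℤ → j ≡ i + 1ℤ
i-j≡-1⇒j≡i+1 {i} {j} i-j≡-1 = trans (eq i j) (cong (λ k → i - k) i-j≡-1)
  where
  eq : ∀ i j → j ≡ i - (i - j)
  eq = solve-∀

point-Move : ∀ stay {y x} → Near y x → Move stay y x (point stay y x)
point-Move stay {y} {x} near with x - y ℤ.≟ 1ℤ
... | yes x-y≡1 with refl ← i-j≡k⇒i≡j+k {x} {y} x-y≡1 = rise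
... | no  x-y≢1 with x - y ℤ.≟ -1ℤ
...   | yes x-y≡-1 with refl ← i-j≡-1⇒j≡i+1 {x} {y} x-y≡-1 = fall
...   | no  x-y≢-1 with x ∈? stay | near
...     | _          | inj₁ x-y≡1         = contradiction x-y≡1 x-y≢1
...     | _          | inj₂ (inj₁ x-y≡-1) = contradiction x-y≡-1 x-y≢-1
...     | yes x∈stay | inj₂ (inj₂ refl)   = rest x∈stay
...     | no  x∉stay | inj₂ (inj₂ refl)   = jump x∉stay

module _ {stay : List ℤ} where

  Move⇒UpStep : ∀ {y x z} → Move stay y x z → z - y ≡ 0ℤ ⊎ z - y ≡ 1ℤ
  Move⇒UpStep (rise {y})   = inj₂ (i+1-i≡1 y)
  Move⇒UpStep (fall {x})   = inj₁ (ℤ.+-inverseʳ (x + 1ℤ))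
  Move⇒UpStep (rest {x} _) = inj₁ (ℤ.+-inverseʳ x)
  Move⇒UpStep (jump {x} _) = inj₂ (i+1-i≡1 x)

  Move⇒DownStep : ∀ {y x z} → Move stay y x z → x - z ≡ -1ℤ ⊎ x - z ≡ 0ℤ
  Move⇒DownStep (rise {y})   = inj₂ (ℤ.+-inverseʳ (y + 1ℤ))
  Move⇒DownStep (fall {x})   = inj₁ (i-[i+1]≡-1 x)
  Move⇒DownStep (rest {x} _) = inj₂ (ℤ.+-inverseʳ x)
  Move⇒DownStep (jump {x} _) = inj₁ (i-[i+1]≡-1 x)

  Move-x≤z : ∀ {y x z} → Move stay y x z → x ≤ᶻ z
  Move-x≤z rise     = ℤ.≤-refl
  Move-x≤z fall     = ℤ.<⇒≤ (i<i+1 _)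
  Move-x≤z (rest _) = ℤ.≤-refl
  Move-x≤z (jump _) = ℤ.<⇒≤ (i<i+1 _)

  Move-y≤z : ∀ {y x z} → Move stay y x z → y ≤ᶻ z
  Move-y≤z rise     = ℤ.<⇒≤ (i<i+1 _)
  Move-y≤z fall     = ℤ.≤-refl
  Move-y≤z (rest _) = ℤ.≤-refl
  Move-y≤z (jump _) = ℤ.<⇒≤ (i<i+1 _)

  Move-z≤x+1 : ∀ {y x z} → Move stay y x z → z ≤ᶻ x + 1ℤ
  Move-z≤x+1 rise     = ℤ.<⇒≤ (i<i+1 _)
  Move-z≤x+1 fall     = ℤ.≤-refl
  Move-z≤x+1 (rest _) = ℤ.<⇒≤ (i<i+1 _)
  Move-z≤x+1 (jump _) = ℤ.≤-refl

  Move-z≤y+1 : ∀ {y x z} → Move stay y x z → z ≤ᶻ y + 1ℤ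
  Move-z≤y+1 rise     = ℤ.≤-refl
  Move-z≤y+1 fall     = ℤ.<⇒≤ (i<i+1 _)
  Move-z≤y+1 (rest _) = ℤ.<⇒≤ (i<i+1 _)
  Move-z≤y+1 (jump _) = ℤ.≤-refl

  -- A particle that rises, falls or rests ends at x or at y, while its right neighbour ends at or
  -- above both x′ and y′. A jumping particle could only meet a neighbour resting at x + 1, and this
  -- is what `Downward` forbids.
  Move-mono : ∀ {y x z y′ x′ z′ cs} → Downward (_∈ˡ stay) cs →
    (x ≡ y → x ∈ˡ cs) → (x′ ≡ y′ → x′ ∈ˡ cs) →
    Move stay y x z → Move stay y′ x′ z′ → y <ᶻ y′ → x <ᶻ x′ → z <ᶻ z′
  Move-mono down x∈ x′∈ rise     m y<y′ x<x′ = ℤ.<-≤-trans x<x′ (Move-x≤z m)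
  Move-mono down x∈ x′∈ fall     m y<y′ x<x′ = ℤ.<-≤-trans y<y′ (Move-y≤z m)
  Move-mono down x∈ x′∈ (rest _) m y<y′ x<x′ = ℤ.<-≤-trans x<x′ (Move-x≤z m)
  Move-mono down x∈ x′∈ (jump _) rise     y<y′ x<x′ = ℤ.≤-<-trans (<⇒+1≤ y<y′) (i<i+1 _)
  Move-mono down x∈ x′∈ (jump _) fall     y<y′ x<x′ = ℤ.≤-<-trans (<⇒+1≤ x<x′) (i<i+1 _)
  Move-mono down x∈ x′∈ (jump _) (jump _) y<y′ x<x′ = ℤ.≤-<-trans (<⇒+1≤ x<x′) (i<i+1 _)
  Move-mono {x = x} {x′ = x′} down x∈ x′∈ (jump x∉stay) (rest x′∈stay) y<y′ x<x′ =
    ℤ.≤∧≢⇒< (<⇒+1≤ x<x′) λ { refl → x∉stay (down x (x∈ refl) (x′∈ refl) x′∈stay) }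

-- The upper bounds are those of 𝔛^{S,t} sharpened for the particle i.
record Valid {N} (T S t : ℕ) (x : Configuration N) : Set where
  field
    increasing : Increasing x
    0≤     : ∀ i → 0ℤ ≤ᶻ lookup x i
    t+S-T≤ : ∀ i → + t + + S - + T ≤ᶻ lookup x i
    ≤S+i   : ∀ i → lookup x i ≤ᶻ + S + + toℕ i
    ≤t+i   : ∀ i → lookup x i ≤ᶻ + t + + toℕ i

coincidences-complete : ∀ {N} (y x : Configuration N) i → lookup x i ≡ lookup y i →
  lookup x i ∈ˡ coincidences y x
coincidences-complete (y ∷ ys) (x ∷ xs) Fin.zero    x≡y with x ℤ.≟ y
... | yes _  = here refl
... | no x≢y = contradiction x≡y x≢y
coincidences-complete (y ∷ ys) (x ∷ xs) (Fin.suc i) x≡y with x ℤ.≟ y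
... | yes _ = there (coincidences-complete ys xs i x≡y)
... | no  _ = coincidences-complete ys xs i x≡y

coincidences-All : ∀ {N} {P : ℤ → Set} (y x : Configuration N) → (∀ i → P (lookup x i)) →
  All P (coincidences y x)
coincidences-All []       []       _  = []
coincidences-All (y ∷ ys) (x ∷ xs) Px with x ℤ.≟ y
... | yes _ = Px Fin.zero ∷ coincidences-All ys xs (Px ∘ Fin.suc)
... | no  _ = coincidences-All ys xs (Px ∘ Fin.suc)

Increasing-tail : ∀ {N x} {xs : Configuration N} → Increasing (x ∷ xs) → Increasing xs
Increasing-tail inc i j i<j = inc (Fin.suc i) (Fin.suc j) (ℕ.s≤s i<j)

coincidences-Ascending : ∀ {N m} (y x : Configuration N) → Increasing x → (∀ i → m <ᶻ lookup x i) →
  Ascending m (coincidences y x)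
coincidences-Ascending []       []       _   _   = tt
coincidences-Ascending (y ∷ ys) (x ∷ xs) inc m<x with x ℤ.≟ y
... | yes _ = m<x Fin.zero , coincidences-Ascending ys xs (Increasing-tail inc)
                (λ i → inc Fin.zero (Fin.suc i) (ℕ.s≤s ℕ.z≤n))
... | no  _ = coincidences-Ascending ys xs (Increasing-tail inc) (m<x ∘ Fin.suc)

0≤⇒≡+ : ∀ {i} → 0ℤ ≤ᶻ i → ∃ λ n → i ≡ + n
0≤⇒≡+ {+ n} _ = n , refl

module _ (N T S : ℕ) where

  newPoint-return : ∀ stay {y x} → Near y x → newPoint N T S stay y x ≡ return (point stay y x)
  newPoint-return stay {y} {x} near with x - y ℤ.≟ 1ℤ | x - y ℤ.≟ -1ℤ | x ℤ.≟ y
  ... | yes _    | _         | _       = refl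
  ... | no _     | yes _     | _       = refl
  ... | no _     | no _      | yes _   = refl
  ... | no x-y≢1 | no x-y≢-1 | no x≢y with near
  ...   | inj₁ x-y≡1         = contradiction x-y≡1 x-y≢1
  ...   | inj₂ (inj₁ x-y≡-1) = contradiction x-y≡-1 x-y≢-1
  ...   | inj₂ (inj₂ x≡y)    = contradiction x≡y x≢y

  newPoint-stuck : ∀ stay {y x} → ¬ Near y x → newPoint N T S stay y x ≡ stuck
  newPoint-stuck stay {y} {x} ¬near with x - y ℤ.≟ 1ℤ | x - y ℤ.≟ -1ℤ | x ℤ.≟ y
  ... | yes x-y≡1 | _          | _       = contradiction (inj₁ x-y≡1) ¬near
  ... | no _      | yes x-y≡-1 | _       = contradiction (inj₂ (inj₁ x-y≡-1)) ¬near
  ... | no _      | no _       | yes x≡y = contradiction (inj₂ (inj₂ x≡y)) ¬near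
  ... | no _      | no _       | no _    = refl

near? : ∀ y x → Dec (Near y x)
near? y x = (x - y ℤ.≟ 1ℤ) ⊎-dec (x - y ℤ.≟ -1ℤ) ⊎-dec (x ℤ.≟ y)

AllNear : ∀ {n} → Configuration n → Configuration n → Set
AllNear y x = ∀ i → Near (lookup y i) (lookup x i)

allNear? : ∀ {n} (y x : Configuration n) → Dec (AllNear y x)
allNear? y x = Fin.all? λ i → near? (lookup y i) (lookup x i)

module _ (N T S : ℕ) where

  newPoints-return : ∀ {n} stay (y x : Configuration n) → AllNear y x →
    newPoints N T S stay y x ≡ return (zipWith (point stay) y x)
  newPoints-return stay []       []       _    = refl
  newPoints-return stay (y ∷ ys) (x ∷ xs) near
    rewrite newPoint-return N T S stay (near Fin.zero)
          | newPoints-return stay ys xs (near ∘ Fin.suc) = refl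

  newPoints-stuck : ∀ {n} stay (y x : Configuration n) → ¬ AllNear y x →
    newPoints N T S stay y x ≡ stuck
  newPoints-stuck stay []       []       ¬near = contradiction (λ ()) ¬near
  newPoints-stuck stay (y ∷ ys) (x ∷ xs) ¬near with near? y x
  ... | no ¬near₀ rewrite newPoint-stuck N T S stay ¬near₀ = refl
  ... | yes near₀
    rewrite newPoint-return N T S stay near₀
          | newPoints-stuck stay ys xs (λ near → ¬near λ { Fin.zero → near₀ ; (Fin.suc i) → near i })
          = refl

  module _ {t : ℕ} {x : Configuration N} (validₓ : Valid T S (suc t) x) where
    open Valid validₓ

    0≤shift : ∀ i → 0ℤ ≤ᶻ shift N T S t (lookup x i)
    0≤shift i = subst (0ℤ ≤ᶻ_) (eq (lookup x i) (+ T) (+ t) (+ S)) (gap-≤ (t+S-T≤ i))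
      where
      eq : ∀ x T t S → x - (1ℤ + t + S - T) ≡ x + T - t - S - 1ℤ
      eq = solve-∀

    separated : ∀ y → Separated (Admissible N T S t) -1ℤ (blocks (coincidences y x))
    separated y = Ascending⇒Separated -1ℤ (coincidences y x)
      (coincidences-All y x λ i → 0≤⇒≡+ (0≤shift i) , 0≤⇒≡+ (0≤ i))
      (coincidences-Ascending y x increasing λ i → ℤ.<-≤-trans ℤ.-<+ (0≤ i))

    module _ {y : Configuration N} (valid-y : Valid T (suc S) t y) (near : AllNear y x) where
      private
        module Y = Valid valid-y

      module _ {stay} (stays : Stays N T S t (blocks (coincidences y x)) stay) where
        open Stays stays

        private
          z = zipWith (point stay) y x

          move : ∀ i → Move stay (lookup y i) (lookup x i) (lookup z i)
          move i = subst (Move stay (lookup y i) (lookup x i))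
            (sym (Vec.lookup-zipWith (point stay) i y x)) (point-Move stay (near i))

          -- In the three moves other than `rest`, z is one more than x or y, each of which is at or
          -- above the old bound. A resting particle gains nothing and relies on `shift-pos`.
          0<shift : ∀ {y x z} → Move stay y x z →
            0ℤ ≤ᶻ shift N T S t y → 0ℤ ≤ᶻ shift N T S t x → 0ℤ <ᶻ shift N T S t z
          0<shift (rise {y})    0≤y 0≤x = ℤ.≤-<-trans 0≤y (shift-mono N T S t (i<i+1 y))
          0<shift (fall {x})    0≤y 0≤x = ℤ.≤-<-trans 0≤x (shift-mono N T S t (i<i+1 x))
          0<shift (rest x∈stay) 0≤y 0≤x = shift-pos x∈stay
          0<shift (jump {x} _)  0≤y 0≤x = ℤ.≤-<-trans 0≤x (shift-mono N T S t (i<i+1 x))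

          lower : ∀ i → + suc t + + suc S - + T ≤ᶻ lookup z i
          lower i = ≤-gap (gap-< (0<shift (move i)
              (subst (0ℤ ≤ᶻ_) (eq₁ (lookup y i) (+ T) (+ t) (+ S)) (gap-≤ (Y.t+S-T≤ i))) (0≤shift i)))
              (eq₂ (lookup z i) (+ T) (+ t) (+ S))
            where
            eq₁ : ∀ y T t S → y - (t + (1ℤ + S) - T) ≡ y + T - t - S - 1ℤ
            eq₁ = solve-∀
            eq₂ : ∀ z T t S → z + T - t - S - 1ℤ - 0ℤ - 1ℤ ≡ z - (1ℤ + t + (1ℤ + S) - T)
            eq₂ = solve-∀

          raise : ∀ m i → + m + + i + 1ℤ ≡ + suc m + + i
          raise m i = eq (+ m) (+ i)
            where
            eq : ∀ m i → m + i + 1ℤ ≡ 1ℤ + m + i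
            eq = solve-∀

          ∈-points : ∀ i → lookup x i ≡ lookup y i → lookup x i ∈ˡ points (blocks (coincidences y x))
          ∈-points i x≡y = subst (lookup x i ∈ˡ_) (sym (points-blocks (coincidences y x)))
            (coincidences-complete y x i x≡y)

        Valid-step : Valid T (suc S) (suc t) z
        Valid-step = record
          { increasing = λ i j i<j → Move-mono downward (∈-points i) (∈-points j) (move i) (move j)
              (Y.increasing i j i<j) (increasing i j i<j)
          ; 0≤     = λ i → ℤ.≤-trans (0≤ i) (Move-x≤z (move i))
          ; t+S-T≤ = lower
          ; ≤S+i   = λ i → subst (lookup z i ≤ᶻ_) (raise S (toℕ i))
              (ℤ.≤-trans (Move-z≤x+1 (move i)) (ℤ.+-monoˡ-≤ 1ℤ (≤S+i i)))
          ; ≤t+i   = λ i → subst (lookup z i ≤ᶻ_) (raise t (toℕ i))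
              (ℤ.≤-trans (Move-z≤y+1 (move i)) (ℤ.+-monoˡ-≤ 1ℤ (Y.≤t+i i)))
          }

        UpStep-step : UpStep y z
        UpStep-step i = Move⇒UpStep (move i)

        DownStep-step : DownStep z x
        DownStep-step i = Move⇒DownStep (move i)

      Almost-step : Almost (λ z → Valid T (suc S) (suc t) z × UpStep y z × DownStep z x)
        (step N T S t y x)
      Almost-step = Almost->>= (stayingPoints N T S t (blocks (coincidences y x)))
        (Almost-stayingPoints N T S t (blocks (coincidences y x)) (separated y))
        λ stay stays → subst (Almost _) (sym (newPoints-return stay y x near))
          (Valid-step stays , UpStep-step stays , DownStep-step stays)

-- Transition probabilities

-- `Move` without the sampled set: the classification that a target z itself determines once y to z
-- and z to x are admissible steps.
data Choice : ℤ → ℤ → ℤ → Set where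
  rise : ∀ {y} → Choice y (y + 1ℤ) (y + 1ℤ)
  fall : ∀ {x} → Choice (x + 1ℤ) x (x + 1ℤ)
  rest : ∀ {x} → Choice x x x
  jump : ∀ {x} → Choice x x (x + 1ℤ)

steps⇒Choice : ∀ {y x z} → z - y ≡ 0ℤ ⊎ z - y ≡ 1ℤ → x - z ≡ -1ℤ ⊎ x - z ≡ 0ℤ → Choice y x z
steps⇒Choice {y} {x} {z} (inj₁ p) (inj₁ q)
  with refl ← ℤ.i-j≡0⇒i≡j z y p | refl ← i-j≡-1⇒j≡i+1 {x} {z} q = fall
steps⇒Choice {y} {x} {z} (inj₁ p) (inj₂ q)
  with refl ← ℤ.i-j≡0⇒i≡j z y p | refl ← ℤ.i-j≡0⇒i≡j x z q = rest
steps⇒Choice {y} {x} {z} (inj₂ p) (inj₁ q)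
  with refl ← +1-injective {x} {y} (trans (sym (i-j≡-1⇒j≡i+1 {x} {z} q)) (i-j≡k⇒i≡j+k {z} {y} p))
     | refl ← i-j≡-1⇒j≡i+1 {x} {z} q = jump
steps⇒Choice {y} {x} {z} (inj₂ p) (inj₂ q)
  with refl ← ℤ.i-j≡0⇒i≡j x z q | refl ← i-j≡k⇒i≡j+k {z} {y} p = rise

Choice⇒Near : ∀ {y x z} → Choice y x z → Near y x
Choice⇒Near (rise {y}) = inj₁ (i+1-i≡1 y)
Choice⇒Near (fall {x}) = inj₂ (inj₁ (i-[i+1]≡-1 x))
Choice⇒Near rest       = inj₂ (inj₂ refl)
Choice⇒Near jump       = inj₂ (inj₂ refl)

i+1≢i : ∀ {i} → i + 1ℤ ≢ i
i+1≢i {i} eq = ℤ.<-irrefl (sym eq) (i<i+1 i)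

i≢i+1 : ∀ {i} → i ≢ i + 1ℤ
i≢i+1 eq = i+1≢i (sym eq)

-- flags x z (xᵢ) tells whether zᵢ = xᵢ; elsewhere its value is irrelevant.
flags : ∀ {n} → Configuration n → Configuration n → ℤ → Bool
flags []       []       v = false
flags (x ∷ xs) (z ∷ zs) v = if does (v ℤ.≟ x) then does (z ℤ.≟ x) else flags xs zs v

flags-lookup : ∀ {n} (x z : Configuration n) → Increasing x → ∀ i →
  flags x z (lookup x i) ≡ does (lookup z i ℤ.≟ lookup x i)
flags-lookup (x ∷ xs) (z ∷ zs) inc Fin.zero    = cong
  (λ b → if b then does (z ℤ.≟ x) else flags xs zs x) (dec-true (x ℤ.≟ x) refl)
flags-lookup (x ∷ xs) (z ∷ zs) inc (Fin.suc i) = trans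
  (cong (λ b → if b then does (z ℤ.≟ x) else flags xs zs (lookup xs i))
    (dec-false (lookup xs i ℤ.≟ x) λ eq → ℤ.<-irrefl (sym eq) (inc Fin.zero (Fin.suc i) (ℕ.s≤s ℕ.z≤n))))
  (flags-lookup xs zs (Increasing-tail inc) i)

Increasing-injective : ∀ {n} {x : Configuration n} → Increasing x → ∀ {i j} → lookup x i ≡ lookup x j → i ≡ j
Increasing-injective inc {i} {j} eq with Fin.<-cmp i j
... | tri< i<j _ _ = contradiction eq (ℤ.<⇒≢ (inc i j i<j))
... | tri≈ _ i≡j _ = i≡j
... | tri> _ _ j<i = contradiction (sym eq) (ℤ.<⇒≢ (inc j i j<i))

coincidences-sound : ∀ {n} (y x : Configuration n) {v} → v ∈ˡ coincidences y x →
  ∃ λ i → v ≡ lookup x i × lookup x i ≡ lookup y i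
coincidences-sound []       []       ()
coincidences-sound (y ∷ ys) (x ∷ xs) v∈ with x ℤ.≟ y
coincidences-sound (y ∷ ys) (x ∷ xs) (here v≡x) | yes x≡y = Fin.zero , v≡x , x≡y
coincidences-sound (y ∷ ys) (x ∷ xs) (there v∈) | yes _
  with i , v≡xᵢ , xᵢ≡yᵢ ← coincidences-sound ys xs v∈ = Fin.suc i , v≡xᵢ , xᵢ≡yᵢ
coincidences-sound (y ∷ ys) (x ∷ xs) v∈ | no _
  with i , v≡xᵢ , xᵢ≡yᵢ ← coincidences-sound ys xs v∈ = Fin.suc i , v≡xᵢ , xᵢ≡yᵢ

does-true : {P : Set} (P? : Dec P) → does P? ≡ true → P
does-true (yes p) _ = p

-- If the particle at v + 1 stays and the one at v jumped, both would have the same new position,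
-- contrary to the strict increase of z.
flags-Downward : ∀ {n} (y x z : Configuration n) → Increasing x → Increasing z →
  (∀ i → Choice (lookup y i) (lookup x i) (lookup z i)) →
  Downward (λ v → flags x z v ≡ true) (coincidences y x)
flags-Downward y x z incₓ inc-z choice v v∈ v+1∈ fv+1
  with i , refl , xᵢ≡yᵢ ← coincidences-sound y x v∈
     | j , xᵢ+1≡xⱼ , _  ← coincidences-sound y x v+1∈
  = trans (flags-lookup x z incₓ i) (dec-true (lookup z i ℤ.≟ lookup x i) (zᵢ≡xᵢ (choice i) xᵢ≡yᵢ λ zᵢ≡xᵢ+1 →
      i+1≢i (trans xᵢ+1≡xⱼ (cong (lookup x) (sym (Increasing-injective {x = z} inc-z
        (trans zᵢ≡xᵢ+1 (trans xᵢ+1≡xⱼ (sym zⱼ≡xⱼ)))))))))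
  where
  zⱼ≡xⱼ = does-true (lookup z j ℤ.≟ lookup x j)
    (trans (sym (flags-lookup x z incₓ j)) (trans (cong (flags x z) (sym xᵢ+1≡xⱼ)) fv+1))
  zᵢ≡xᵢ : ∀ {y x z} → Choice y x z → x ≡ y → (z ≢ x + 1ℤ) → z ≡ x
  zᵢ≡xᵢ rise x≡y _ = refl
  zᵢ≡xᵢ fall x≡y z≢ = contradiction refl z≢
  zᵢ≡xᵢ rest x≡y _ = refl
  zᵢ≡xᵢ jump x≡y z≢ = contradiction refl z≢

_≟ᶜ_ : ∀ {n} → DecidableEquality (Configuration n)
_≟ᶜ_ = Vec.≡-dec ℤ._≟_

ind-∷ : ∀ {n} a b (as bs : Configuration n) →
  ind ((a ∷ as) ≟ᶜ (b ∷ bs)) ≡ ind (a ℤ.≟ b) * ind (as ≟ᶜ bs)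
ind-∷ a b as bs = case (a ℤ.≟ b)
  where
  case : Dec (a ≡ b) → _
  case (yes refl) = trans
    (ind-⇔ ((a ∷ as) ≟ᶜ (a ∷ bs)) (as ≟ᶜ bs) (λ { refl → refl }) (cong (a ∷_)))
    (sym (trans (cong (_* ind (as ≟ᶜ bs)) (ind-yes (a ℤ.≟ a) refl)) (ℚ.*-identityˡ _)))
  case (no a≢b) = trans
    (ind-no ((a ∷ as) ≟ᶜ (b ∷ bs)) λ { refl → a≢b refl })
    (sym (trans (cong (_* ind (as ≟ᶜ bs)) (ind-no (a ℤ.≟ b) a≢b)) (ℚ.*-zeroˡ (ind (as ≟ᶜ bs)))))

point-rise : ∀ stay y → point stay y (y + 1ℤ) ≡ y + 1ℤ
point-rise stay y rewrite dec-true (y + 1ℤ - y ℤ.≟ 1ℤ) (i+1-i≡1 y) = refl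

point-fall : ∀ stay x → point stay (x + 1ℤ) x ≡ x + 1ℤ
point-fall stay x rewrite i-[i+1]≡-1 x = refl

point-same : ∀ stay x → point stay x x ≡ (if does (x ∈? stay) then x else x + 1ℤ)
point-same stay x rewrite ℤ.+-inverseʳ x = refl

ind-point : ∀ stay {y x z} → Choice y x z → ind (point stay y x ℤ.≟ z) ≡
  (if does (x ℤ.≟ y) then match (does (x ∈? stay)) (does (z ℤ.≟ x)) else 1ℚ)
ind-point stay (rise {y})
  rewrite point-rise stay y | dec-false (y + 1ℤ ℤ.≟ y) i+1≢i = ind-yes (y + 1ℤ ℤ.≟ y + 1ℤ) refl
ind-point stay (fall {x})
  rewrite point-fall stay x | dec-false (x ℤ.≟ x + 1ℤ) i≢i+1 = ind-yes (x + 1ℤ ℤ.≟ x + 1ℤ) refl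
ind-point stay (rest {x}) rewrite point-same stay x | dec-true (x ℤ.≟ x) refl with does (x ∈? stay)
... | true  = ind-yes (x ℤ.≟ x) refl
... | false = ind-no (x + 1ℤ ℤ.≟ x) i+1≢i
ind-point stay (jump {x}) rewrite point-same stay x | dec-true (x ℤ.≟ x) refl
  | dec-false (x + 1ℤ ℤ.≟ x) i+1≢i with does (x ∈? stay)
... | true  = ind-no (x ℤ.≟ x + 1ℤ) i≢i+1
... | false = ind-yes (x + 1ℤ ℤ.≟ x + 1ℤ) refl

prodˡ-coincidences-∷ : ∀ {n} (g : ℤ → ℚ) y x (ys xs : Configuration n) →
  prodˡ g (coincidences (y ∷ ys) (x ∷ xs)) ≡
  (if does (x ℤ.≟ y) then g x else 1ℚ) * prodˡ g (coincidences ys xs)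
prodˡ-coincidences-∷ g y x ys xs with does (x ℤ.≟ y)
... | true  = refl
... | false = sym (ℚ.*-identityˡ _)

ind-zipWith-point : ∀ {n} stay (f : ℤ → Bool) (y x z : Configuration n) →
  (∀ i → f (lookup x i) ≡ does (lookup z i ℤ.≟ lookup x i)) →
  (∀ i → Choice (lookup y i) (lookup x i) (lookup z i)) →
  ind (zipWith (point stay) y x ≟ᶜ z) ≡ prodˡ (λ c → match (does (c ∈? stay)) (f c)) (coincidences y x)
ind-zipWith-point stay f []       []       []       f≗ choice = refl
ind-zipWith-point stay f (y ∷ ys) (x ∷ xs) (z ∷ zs) f≗ choice = begin
  ind (zipWith (point stay) (y ∷ ys) (x ∷ xs) ≟ᶜ (z ∷ zs))
    ≡⟨ ind-∷ (point stay y x) z (zipWith (point stay) ys xs) zs ⟩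
  ind (point stay y x ℤ.≟ z) * ind (zipWith (point stay) ys xs ≟ᶜ zs)
    ≡⟨ cong₂ _*_
         (trans (ind-point stay (choice Fin.zero))
           (cong (λ b → if does (x ℤ.≟ y) then match (does (x ∈? stay)) b else 1ℚ) (sym (f≗ Fin.zero))))
         (ind-zipWith-point stay f ys xs zs (f≗ ∘ Fin.suc) (choice ∘ Fin.suc)) ⟩
  (if does (x ℤ.≟ y) then match (does (x ∈? stay)) (f x) else 1ℚ) * prodˡ g (coincidences ys xs)
    ≡⟨ prodˡ-coincidences-∷ g y x ys xs ⟨
  prodˡ g (coincidences (y ∷ ys) (x ∷ xs)) ∎
  where
  open ≡-Reasoning
  g : ℤ → ℚ
  g c = match (does (c ∈? stay)) (f c)

-- Factorisation of the path weight over the particles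

*ᶻ-pos : ∀ {i j} → 0ℤ <ᶻ i → 0ℤ <ᶻ j → 0ℤ <ᶻ i *ᶻ j
*ᶻ-pos {+ suc m} {+ suc n} _ _ = ℤ.+<+ (ℕ.s≤s ℕ.z≤n)
*ᶻ-pos {+ zero}  (ℤ.+<+ ()) _
*ᶻ-pos {+ suc m} {+ zero} _ (ℤ.+<+ ())

Πℤ-pos : ∀ {n} (f : Fin n → ℤ) → (∀ i → 0ℤ <ᶻ f i) → 0ℤ <ᶻ Πℤ f
Πℤ-pos {zero}  f 0<f = ℤ.+<+ (ℕ.s≤s ℕ.z≤n)
Πℤ-pos {suc n} f 0<f = *ᶻ-pos (0<f Fin.zero) (Πℤ-pos (f ∘ Fin.suc) (0<f ∘ Fin.suc))

factor-if-true : {P : Set} (P? : Dec P) {z : ℤ} → P → factor-if P? z ≡ z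
factor-if-true (yes _) _ = refl
factor-if-true (no ¬p) p = contradiction p ¬p

factor-if-false : {P : Set} (P? : Dec P) {z : ℤ} → ¬ P → factor-if P? z ≡ 1ℤ
factor-if-false (yes p) ¬p = contradiction p ¬p
factor-if-false (no _)  _  = refl

0<1ᶻ : 0ℤ <ᶻ 1ℤ
0<1ᶻ = ℤ.+<+ (ℕ.s≤s ℕ.z≤n)

factor-if-pos : {P : Set} (P? : Dec P) {z : ℤ} → (P → 0ℤ <ᶻ z) → 0ℤ <ᶻ factor-if P? z
factor-if-pos (yes p) 0<z = 0<z p
factor-if-pos (no _)  0<z = 0<1ᶻ

Δ-pos : ∀ N T (x : Configuration N) → Increasing x → 0ℤ <ᶻ Δ N T x
Δ-pos N T x inc = Πℤ-pos _ λ i → Πℤ-pos _ λ j → factor-if-pos (i Fin.<? j) λ i<j →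
  i<j⇒0<j-i (inc i j i<j)

module _ (N T S t : ℕ) where

  upFactor restFactor : ℤ → ℤ → ℤ
  upFactor   y z = factor-if (z ℤ.≟ y + 1ℤ) (+ N + + suc S - y - 1ℤ)
  restFactor y z = factor-if (z ℤ.≟ y) (y + + T - + t - + suc S)

  downFactor keepFactor : ℤ → ℤ → ℤ
  downFactor z x = factor-if (x ℤ.≟ z - 1ℤ) z
  keepFactor z x = factor-if (x ℤ.≟ z) (+ suc S + + N - 1ℤ - z)

  -- The part of the four factors at a particle that does not depend on z.
  fixedFactor : ℤ → ℤ → ℤ
  fixedFactor y x =
    if does (x - y ℤ.≟ 1ℤ) then (+ N + + suc S - y - 1ℤ) *ᶻ (+ N + + S - x) else
    if does (x - y ℤ.≟ -1ℤ) then (y + + T - + t - + suc S) *ᶻ y else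
    + N + + S - x

  choiceFactor : ℤ → ℤ → Bool → ℤ
  choiceFactor y x stays = if does (x ℤ.≟ y) then (if stays then shift N T S t x else x + 1ℤ) else 1ℤ

  -- At a coincidence, staying collects N + S - x from `keepFactor` and jumping collects the same
  -- number from `upFactor`. This common value goes into `fixedFactor`, and what is left is the
  -- factor occurring in the weights of `D`.
  Choice-factors : ∀ {y x z} → Choice y x z →
    (upFactor y z *ᶻ restFactor y z) *ᶻ (downFactor z x *ᶻ keepFactor z x) ≡
    fixedFactor y x *ᶻ choiceFactor y x (does (z ℤ.≟ x))
  Choice-factors (rise {y})
    rewrite factor-if-true (y + 1ℤ ℤ.≟ y + 1ℤ) {+ N + + suc S - y - 1ℤ} refl
          | factor-if-false (y + 1ℤ ℤ.≟ y) {y + + T - + t - + suc S} i+1≢i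
          | factor-if-false (y + 1ℤ ℤ.≟ y + 1ℤ - 1ℤ) {y + 1ℤ} (λ eq → i+1≢i (trans eq (i+1-1≡i y)))
          | factor-if-true (y + 1ℤ ℤ.≟ y + 1ℤ) {+ suc S + + N - 1ℤ - (y + 1ℤ)} refl
          | dec-true (y + 1ℤ - y ℤ.≟ 1ℤ) (i+1-i≡1 y)
          | dec-false (y + 1ℤ ℤ.≟ y) i+1≢i = eq y (+ N) (+ S)
    where
    eq : ∀ y N S → (N + (1ℤ + S) - y - 1ℤ) *ᶻ 1ℤ *ᶻ (1ℤ *ᶻ (1ℤ + S + N - 1ℤ - (y + 1ℤ))) ≡
      (N + (1ℤ + S) - y - 1ℤ) *ᶻ (N + S - (y + 1ℤ)) *ᶻ 1ℤ
    eq = solve-∀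
  Choice-factors (fall {x})
    rewrite factor-if-false (x + 1ℤ ℤ.≟ x + 1ℤ + 1ℤ) {+ N + + suc S - (x + 1ℤ) - 1ℤ} i≢i+1
          | factor-if-true (x + 1ℤ ℤ.≟ x + 1ℤ) {x + 1ℤ + + T - + t - + suc S} refl
          | factor-if-true (x ℤ.≟ x + 1ℤ - 1ℤ) {x + 1ℤ} (sym (i+1-1≡i x))
          | factor-if-false (x ℤ.≟ x + 1ℤ) {+ suc S + + N - 1ℤ - (x + 1ℤ)} i≢i+1
          | i-[i+1]≡-1 x
          | dec-false (x ℤ.≟ x + 1ℤ) i≢i+1 = eq x (+ T) (+ t) (+ S)
    where
    eq : ∀ x T t S → 1ℤ *ᶻ (x + 1ℤ + T - t - (1ℤ + S)) *ᶻ ((x + 1ℤ) *ᶻ 1ℤ) ≡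
      (x + 1ℤ + T - t - (1ℤ + S)) *ᶻ (x + 1ℤ) *ᶻ 1ℤ
    eq = solve-∀
  Choice-factors (rest {x})
    rewrite factor-if-false (x ℤ.≟ x + 1ℤ) {+ N + + suc S - x - 1ℤ} i≢i+1
          | factor-if-true (x ℤ.≟ x) {x + + T - + t - + suc S} refl
          | factor-if-false (x ℤ.≟ x - 1ℤ) {x} (λ eq → i+1≢i (trans (cong (_+ 1ℤ) eq) (i-1+1≡i x)))
          | factor-if-true (x ℤ.≟ x) {+ suc S + + N - 1ℤ - x} refl
          | ℤ.+-inverseʳ x
          | dec-true (x ℤ.≟ x) refl = eq x (+ N) (+ T) (+ t) (+ S)
    where
    eq : ∀ x N T t S → 1ℤ *ᶻ (x + T - t - (1ℤ + S)) *ᶻ (1ℤ *ᶻ (1ℤ + S + N - 1ℤ - x)) ≡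
      (N + S - x) *ᶻ (x + T - t - S - 1ℤ)
    eq = solve-∀
  Choice-factors (jump {x})
    rewrite factor-if-true (x + 1ℤ ℤ.≟ x + 1ℤ) {+ N + + suc S - x - 1ℤ} refl
          | factor-if-false (x + 1ℤ ℤ.≟ x) {x + + T - + t - + suc S} i+1≢i
          | factor-if-true (x ℤ.≟ x + 1ℤ - 1ℤ) {x + 1ℤ} (sym (i+1-1≡i x))
          | factor-if-false (x ℤ.≟ x + 1ℤ) {+ suc S + + N - 1ℤ - (x + 1ℤ)} i≢i+1
          | ℤ.+-inverseʳ x
          | dec-true (x ℤ.≟ x) refl
          | dec-false (x + 1ℤ ℤ.≟ x) i+1≢i = eq x (+ N) (+ S)
    where
    eq : ∀ x N S → (N + (1ℤ + S) - x - 1ℤ) *ᶻ 1ℤ *ᶻ ((x + 1ℤ) *ᶻ 1ℤ) ≡ (N + S - x) *ᶻ (x + 1ℤ)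
    eq = solve-∀

  fixedFactor-pos : ∀ {y x} → Near y x → 0ℤ ≤ᶻ x → 0ℤ ≤ᶻ shift N T S t x → x <ᶻ + N + + S →
    0ℤ <ᶻ fixedFactor y x
  fixedFactor-pos {y} {x} near 0≤x 0≤shift x<N+S with x - y ℤ.≟ 1ℤ
  ... | yes x-y≡1 with refl ← i-j≡k⇒i≡j+k {x} {y} x-y≡1 = *ᶻ-pos {+ N + + suc S - y - 1ℤ} {+ N + + S - (y + 1ℤ)}
    (<-gap (gap-< x<N+S ⊕ 0≤+ 1) (eq y (+ N) (+ S)))
    (i<j⇒0<j-i x<N+S)
    where
    eq : ∀ y N S → N + S - (y + 1ℤ) - 1ℤ + 1ℤ ≡ N + (1ℤ + S) - y - 1ℤ - 0ℤ - 1ℤ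
    eq = solve-∀
  ... | no x-y≢1 with x - y ℤ.≟ -1ℤ
  ...   | yes x-y≡-1 with refl ← i-j≡-1⇒j≡i+1 {x} {y} x-y≡-1 = *ᶻ-pos {x + 1ℤ + + T - + t - + suc S} {x + 1ℤ}
    (<-gap 0≤shift (eq x (+ T) (+ t) (+ S))) (ℤ.≤-<-trans 0≤x (i<i+1 x))
    where
    eq : ∀ x T t S → x + T - t - S - 1ℤ ≡ x + 1ℤ + T - t - (1ℤ + S) - 0ℤ - 1ℤ
    eq = solve-∀
  ...   | no _ = i<j⇒0<j-i x<N+S

  ι-Πℤ-choiceFactor : ∀ {n} (f : ℤ → Bool) (y x z : Configuration n) →
    (∀ i → f (lookup x i) ≡ does (lookup z i ℤ.≟ lookup x i)) →
    ι (Πℤ λ i → choiceFactor (lookup y i) (lookup x i) (does (lookup z i ℤ.≟ lookup x i))) ≡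
    prodˡ (λ c → jumpOrStay N T S t c (f c)) (coincidences y x)
  ι-Πℤ-choiceFactor f []       []       []       f≗ = refl
  ι-Πℤ-choiceFactor f (y ∷ ys) (x ∷ xs) (z ∷ zs) f≗ = begin
    ι (choiceFactor y x (does (z ℤ.≟ x)) *ᶻ rest-prod)
      ≡⟨ ι-* (choiceFactor y x (does (z ℤ.≟ x))) rest-prod ⟩
    ι (choiceFactor y x (does (z ℤ.≟ x))) * ι rest-prod
      ≡⟨ cong₂ _*_
           (trans (cong (ι ∘ choiceFactor y x) (sym (f≗ Fin.zero))) (ι-choice (does (x ℤ.≟ y))))
           (ι-Πℤ-choiceFactor f ys xs zs (f≗ ∘ Fin.suc)) ⟩
    (if does (x ℤ.≟ y) then jumpOrStay N T S t x (f x) else 1ℚ) * prodˡ g (coincidences ys xs)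
      ≡⟨ prodˡ-coincidences-∷ g y x ys xs ⟨
    prodˡ g (coincidences (y ∷ ys) (x ∷ xs)) ∎
    where
    open ≡-Reasoning
    rest-prod = Πℤ λ i → choiceFactor (lookup ys i) (lookup xs i) (does (lookup zs i ℤ.≟ lookup xs i))
    g : ℤ → ℚ
    g c = jumpOrStay N T S t c (f c)
    ι-choice : ∀ b → ι (if b then (if f x then shift N T S t x else x + 1ℤ) else 1ℤ) ≡
      (if b then jumpOrStay N T S t x (f x) else 1ℚ)
    ι-choice true  = refl
    ι-choice false = refl

-- The state space `𝒳`

vectors-complete : ∀ n {as : List ℤ} (v : Vec ℤ n) → (∀ i → lookup v i ∈ˡ as) → v ∈ˡ vectors n as
vectors-complete zero    []      _  = here refl
vectors-complete (suc n) (a ∷ v) v∈ =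
  ∈-cartesianProductWith⁺ _∷_ (v∈ Fin.zero) (vectors-complete n v (v∈ ∘ Fin.suc))

vectors-Unique : ∀ n {as : List ℤ} → Unique as → Unique (vectors n as)
vectors-Unique zero    u = [] ∷ []
vectors-Unique (suc n) u = Unique.cartesianProductWith⁺ _∷_ Vec.∷-injective u (vectors-Unique n u)

if-false : ∀ {b} {p q : ℚ} → b ≡ false → (if b then p else q) ≡ q
if-false refl = refl

module _ (N T S t : ℕ) where

  𝒳-Unique : Unique (𝒳 N T S t)
  𝒳-Unique = Unique.filter⁺ increasing? (vectors-Unique N
    (Unique.filter⁺ _ (Unique.map⁺ ℤ.+-injective (Unique.upTo⁺ (S ℕ.+ N)))))

  Valid⇒∈𝒳 : ∀ {z : Configuration N} → Valid T S t z → z ∈ˡ 𝒳 N T S t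
  Valid⇒∈𝒳 {z} valid = ∈-filter⁺ increasing? (vectors-complete N z ∈𝔛) increasing
    where
    open Valid valid
    ≤last : ∀ m i → + m + + toℕ {N} i ≤ᶻ + m + + N - 1ℤ
    ≤last m i = ≤-gap (gap-< (ℤ.+<+ (Fin.toℕ<n i))) (eq (+ m) (+ N) (+ toℕ i))
      where
      eq : ∀ m n i → n - i - 1ℤ ≡ m + n - 1ℤ - (m + i)
      eq = solve-∀
    ∈upTo : ∀ {v} → 0ℤ ≤ᶻ v → v <ᶻ + (S ℕ.+ N) → v ∈ˡ map +_ (upTo (S ℕ.+ N))
    ∈upTo {+ n} _ (ℤ.+<+ n<S+N) = ∈-map⁺ +_ (∈-upTo⁺ n<S+N)
    ∈𝔛 : ∀ i → lookup z i ∈ˡ 𝔛 N T S t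
    ∈𝔛 i = ∈-filter⁺ _
      (∈upTo (0≤ i) (ℤ.≤-<-trans (≤S+i i) (ℤ.+<+ (ℕ.+-monoʳ-< S (Fin.toℕ<n i)))))
      ( ℤ.⊔-lub (0≤ i) (t+S-T≤ i)
      , ℤ.⊓-glb (ℤ.≤-trans (≤t+i i) (≤last t i)) (ℤ.≤-trans (≤S+i i) (≤last S i)))

-- Law of one step

module _ (N T S t : ℕ) (t<T : t < T) {y x : Configuration N}
         (valid-y : Valid T (suc S) t y) (valid-x : Valid T S (suc t) x) where
  private
    module Y = Valid valid-y
    module X = Valid valid-x

  pathWeight : Configuration N → ℚ
  pathWeight z = P-t+ N T (suc S) t y z * P-S- N T (suc S) (suc t) z x

  R₁ R₂ : ℕ
  R₁ = rising (T ℕ.∸ t) N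
  R₂ = rising (suc S) N

  0<R₁Δy : 0ℤ <ᶻ + R₁ *ᶻ Δ N T y
  0<R₁Δy = *ᶻ-pos (ℤ.+<+ (rising-pos (T ℕ.∸ t) N (ℕ.m<n⇒0<n∸m t<T))) (Δ-pos N T y Y.increasing)

  -- The denominators of the two matrices without the Vandermonde factor of z, hence the same for
  -- all z.
  β : ℚ
  β = ι (+ R₁ *ᶻ Δ N T y) * ι (+ R₂)

  β-pos : 0ℚ ℚ.< β
  β-pos = *-pos (ι-pos 0<R₁Δy) (ι-pos (ℤ.+<+ (rising-pos (suc S) N (ℕ.s≤s ℕ.z≤n))))

  fixedWeight : ℤ
  fixedWeight = Πℤ λ i → fixedFactor N T S t (lookup y i) (lookup x i)

  pathWeight-¬steps : ∀ {z} → ¬ (UpStep y z × DownStep z x) → pathWeight z ≡ 0ℚ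
  pathWeight-¬steps {z} ¬steps = case (upStep? y z) (downStep? z x)
    where
    case : Dec (UpStep y z) → Dec (DownStep z x) → pathWeight z ≡ 0ℚ
    case (no ¬up) _ = *-≡0ˡ (P-S- N T (suc S) (suc t) z x) (if-false (dec-false (upStep? y z) ¬up))
    case (yes up) (no ¬down) = trans
      (cong (P-t+ N T (suc S) t y z *_) (if-false (dec-false (downStep? z x) ¬down)))
      (ℚ.*-zeroʳ (P-t+ N T (suc S) t y z))
    case (yes up) (yes down) = contradiction (up , down) ¬steps

  module _ {z : Configuration N} (incr : Increasing z) (up : UpStep y z) (down : DownStep z x) where
    private
      choice : ∀ i → Choice (lookup y i) (lookup x i) (lookup z i)
      choice i = steps⇒Choice (up i) (down i)

      ups rests downs keeps choices : ℤ
      ups   = Πℤ λ i → upFactor   N T S t (lookup y i) (lookup z i)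
      rests = Πℤ λ i → restFactor N T S t (lookup y i) (lookup z i)
      downs = Πℤ λ i → downFactor N T S t (lookup z i) (lookup x i)
      keeps = Πℤ λ i → keepFactor N T S t (lookup z i) (lookup x i)
      choices = Πℤ λ i → choiceFactor N T S t (lookup y i) (lookup x i) (does (lookup z i ℤ.≟ lookup x i))

      Πℤ-factors : ups *ᶻ rests *ᶻ (downs *ᶻ keeps) ≡ fixedWeight *ᶻ choices
      Πℤ-factors = begin
        ups *ᶻ rests *ᶻ (downs *ᶻ keeps)  ≡⟨ cong₂ _*ᶻ_ (Πℤ-* a b) (Πℤ-* c d) ⟨
        Πℤ (λ i → a i *ᶻ b i) *ᶻ Πℤ (λ i → c i *ᶻ d i) ≡⟨ Πℤ-* (λ i → a i *ᶻ b i) (λ i → c i *ᶻ d i) ⟨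
        Πℤ (λ i → a i *ᶻ b i *ᶻ (c i *ᶻ d i))  ≡⟨ (Πℤ-cong λ i → Choice-factors N T S t (choice i)) ⟩
        Πℤ (λ i → e i *ᶻ f i)                  ≡⟨ Πℤ-* e f ⟩
        fixedWeight *ᶻ choices                 ∎
        where
        open ≡-Reasoning
        a b c d e f : Fin N → ℤ
        a i = upFactor   N T S t (lookup y i) (lookup z i)
        b i = restFactor N T S t (lookup y i) (lookup z i)
        c i = downFactor N T S t (lookup z i) (lookup x i)
        d i = keepFactor N T S t (lookup z i) (lookup x i)
        e i = fixedFactor N T S t (lookup y i) (lookup x i)
        f i = choiceFactor N T S t (lookup y i) (lookup x i) (does (lookup z i ℤ.≟ lookup x i))

      0<Δz = Δ-pos N T z incr

      P-t+-up : P-t+ N T (suc S) t y z * ι (+ R₁ *ᶻ Δ N T y) ≡ ι (Δ N T z *ᶻ ups *ᶻ rests)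
      P-t+-up = trans
        (cong (λ b → (if b then ι (Δ N T z *ᶻ ups *ᶻ rests) ÷₀ ι (+ R₁ *ᶻ Δ N T y) else 0ℚ) * ι (+ R₁ *ᶻ Δ N T y))
          (dec-true (upStep? y z) up))
        (÷₀-*-cancel (ι (Δ N T z *ᶻ ups *ᶻ rests)) (pos⇒≢0 (ι-pos 0<R₁Δy)))

      P-S--down : P-S- N T (suc S) (suc t) z x * ι (+ R₂ *ᶻ Δ N T z) ≡ ι (Δ N T x *ᶻ downs *ᶻ keeps)
      P-S--down = trans
        (cong (λ b → (if b then ι (Δ N T x *ᶻ downs *ᶻ keeps) ÷₀ ι (+ R₂ *ᶻ Δ N T z) else 0ℚ) * ι (+ R₂ *ᶻ Δ N T z))
          (dec-true (downStep? z x) down))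
        (÷₀-*-cancel (ι (Δ N T x *ᶻ downs *ᶻ keeps)) (pos⇒≢0 (ι-pos
          (*ᶻ-pos (ℤ.+<+ (rising-pos (suc S) N (ℕ.s≤s ℕ.z≤n))) 0<Δz))))

      f : ℤ → Bool
      f = flags x z

      f≗ : ∀ i → f (lookup x i) ≡ does (lookup z i ℤ.≟ lookup x i)
      f≗ = flags-lookup x z X.increasing

    pathWeight-steps : pathWeight z * β ≡ ι (Δ N T x *ᶻ fixedWeight) *
      prodˡ (λ c → jumpOrStay N T S t c (flags x z c)) (coincidences y x)
    -- The extra factor Δ(z) clears the denominator of `P-S-`; the numerator of `P-t+` supplies it
    -- on the other side, where it is cancelled.
    pathWeight-steps = *-cancelʳ-≢0 (pos⇒≢0 (ι-pos 0<Δz)) (begin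
      p * q * (d₁ * ι (+ R₂)) * ι (Δ N T z)
        ≡⟨ rearrange p q d₁ (ι (+ R₂)) (ι (Δ N T z)) ⟩
      p * d₁ * (q * (ι (+ R₂) * ι (Δ N T z)))
        ≡⟨ cong₂ _*_ P-t+-up (trans (cong (q *_) (sym (ι-* (+ R₂) (Δ N T z)))) P-S--down) ⟩
      ι (Δ N T z *ᶻ ups *ᶻ rests) * ι (Δ N T x *ᶻ downs *ᶻ keeps)
        ≡⟨ ι-* (Δ N T z *ᶻ ups *ᶻ rests) (Δ N T x *ᶻ downs *ᶻ keeps) ⟨
      ι (Δ N T z *ᶻ ups *ᶻ rests *ᶻ (Δ N T x *ᶻ downs *ᶻ keeps))
        ≡⟨ cong ι (rearrangeᶻ (Δ N T z) ups rests (Δ N T x) downs keeps) ⟩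
      ι (Δ N T x *ᶻ (ups *ᶻ rests *ᶻ (downs *ᶻ keeps)) *ᶻ Δ N T z)
        ≡⟨ cong (λ w → ι (Δ N T x *ᶻ w *ᶻ Δ N T z)) Πℤ-factors ⟩
      ι (Δ N T x *ᶻ (fixedWeight *ᶻ choices) *ᶻ Δ N T z)
        ≡⟨ ι-* (Δ N T x *ᶻ (fixedWeight *ᶻ choices)) (Δ N T z) ⟩
      ι (Δ N T x *ᶻ (fixedWeight *ᶻ choices)) * ι (Δ N T z)
        ≡⟨ cong (_* ι (Δ N T z)) (trans
             (cong ι (sym (ℤ.*-assoc (Δ N T x) fixedWeight choices)))
             (ι-* (Δ N T x *ᶻ fixedWeight) choices)) ⟩
      ι (Δ N T x *ᶻ fixedWeight) * ι choices * ι (Δ N T z)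
        ≡⟨ cong (λ w → ι (Δ N T x *ᶻ fixedWeight) * w * ι (Δ N T z)) (ι-Πℤ-choiceFactor N T S t f y x z f≗) ⟩
      ι (Δ N T x *ᶻ fixedWeight) *
        prodˡ (λ c → jumpOrStay N T S t c (flags x z c)) (coincidences y x) * ι (Δ N T z) ∎)
      where
      open ≡-Reasoning
      p  = P-t+ N T (suc S) t y z
      q  = P-S- N T (suc S) (suc t) z x
      d₁ = ι (+ R₁ *ᶻ Δ N T y)
      rearrange : ∀ p q d r e → p * q * (d * r) * e ≡ p * d * (q * (r * e))
      rearrange = solve 5 (λ p q d r e → p :* q :* (d :* r) :* e := p :* d :* (q :* (r :* e))) refl
        where open +-*-Solver
      rearrangeᶻ : ∀ z a b x c d → z *ᶻ a *ᶻ b *ᶻ (x *ᶻ c *ᶻ d) ≡ x *ᶻ (a *ᶻ b *ᶻ (c *ᶻ d)) *ᶻ z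
      rearrangeᶻ = solve-∀

    Prob-step : AllNear y x → Prob (step N T S t y x) (_≟ᶜ z) ≡
      E (stayingPoints N T S t (blocks (coincidences y x)))
        (stayMatch N T S t (flags x z) (coincidences y x))
    Prob-step near = trans (Prob≡E (step N T S t y x) (_≟ᶜ z))
      (trans (E->>= staying (λ stay → newPoints N T S stay y x) (λ v → ind (v ≟ᶜ z)))
      (E-cong staying λ stay → trans
        (cong (λ m → E m (λ v → ind (v ≟ᶜ z))) (newPoints-return N T S stay y x near))
        (ind-zipWith-point stay f y x z f≗ choice)))
      where staying = stayingPoints N T S t (blocks (coincidences y x))

    flags-Downward′ : Downward (λ c → flags x z c ≡ true) (coincidences y x)
    flags-Downward′ = flags-Downward y x z X.increasing incr choice

  0<fixedWeight : AllNear y x → 0ℤ <ᶻ fixedWeight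
  0<fixedWeight near = Πℤ-pos _ λ i → fixedFactor-pos N T S t (near i) (X.0≤ i)
    (0≤shift N T S valid-x i) (ℤ.≤-<-trans (X.≤S+i i) (subst (+ S + + toℕ i <ᶻ_) (ℤ.+-comm (+ S) (+ N))
      (ℤ.+<+ (ℕ.+-monoʳ-< S (Fin.toℕ<n i)))))

  -- α collects Δ(x), the factors fixed by x and y, and the normalising sums of the blocks. If z is
  -- not joined to y and x by admissible steps, both sides vanish: the left because almost every
  -- outcome is so joined, the right by the definition of the matrices.
  step-proportional : AllNear y x → ∃ λ α → 0ℚ ℚ.< α × (∀ {z} → Increasing z →
    Prob (step N T S t y x) (_≟ᶜ z) * α ≡ pathWeight z * β)
  step-proportional near
    with Z , 0<Z , eq ← E-stayMatch N T S t (blocks (coincidences y x)) (separated N T S valid-x y)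
    rewrite points-blocks (coincidences y x)
    = α′ * Z , *-pos (ι-pos (*ᶻ-pos (Δ-pos N T x X.increasing) (0<fixedWeight near))) 0<Z , λ {z} incr →
      proportional z incr (upStep? y z) (downStep? z x)
    where
    α′ = ι (Δ N T x *ᶻ fixedWeight)
    K = λ z → Prob (step N T S t y x) (_≟ᶜ z)
    K≡0 : ∀ z → ¬ (UpStep y z × DownStep z x) → K z * (α′ * Z) ≡ pathWeight z * β
    K≡0 z ¬steps = trans
      (*-≡0ˡ (α′ * Z) (Prob-∉ _≟ᶜ_ (step N T S t y x) (Almost-step N T S valid-x valid-y near)
        (¬steps ∘ proj₂)))
      (sym (*-≡0ˡ β (pathWeight-¬steps {z} ¬steps)))
    proportional : ∀ z → Increasing z → Dec (UpStep y z) → Dec (DownStep z x) →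
      K z * (α′ * Z) ≡ pathWeight z * β
    proportional z incr (no ¬up)  _          = K≡0 z (¬up ∘ proj₁)
    proportional z incr (yes _)   (no ¬down) = K≡0 z (¬down ∘ proj₂)
    proportional z incr (yes up)  (yes down) = begin
      K z * (α′ * Z)   ≡⟨ cong (_* (α′ * Z)) (Prob-step incr up down near) ⟩
      e * (α′ * Z)     ≡⟨ rearrange e α′ Z ⟩
      α′ * (e * Z)     ≡⟨ cong (α′ *_) (eq (flags x z) (flags-Downward′ incr up down)) ⟩
      α′ * prodˡ (λ c → jumpOrStay N T S t c (flags x z c)) (coincidences y x)
                       ≡⟨ pathWeight-steps incr up down ⟨
      pathWeight z * β ∎
      where
      open ≡-Reasoning
      e = E (stayingPoints N T S t (blocks (coincidences y x)))
        (stayMatch N T S t (flags x z) (coincidences y x))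
      rearrange : ∀ e a z → e * (a * z) ≡ a * (e * z)
      rearrange = solve 3 (λ e a z → e :* (a :* z) := a :* (e :* z)) refl
        where open +-*-Solver

  -- The sign alternative is included because `P-S↦S+1` tests the product of the entries for
  -- positivity. In the zero case the quotient is 0 by the convention of `÷₀`.
  Transition : Set
  Transition = (0ℚ ℚ.< PP N T (suc S) t y x ⊎ PP N T (suc S) t y x ≡ 0ℚ) ×
    (∀ {z} → Increasing z →
      Prob (step N T S t y x) (_≟ᶜ z) ≡ pathWeight z ÷₀ PP N T (suc S) t y x)

  transition-near : AllNear y x → Transition
  transition-near near with α , 0<α , K*α≡W*β ← step-proportional near
    = inj₁ 0<PP , λ {z} incr → ÷₀-unique (pos⇒≢0 0<PP) (*-cancelʳ-≢0 (pos⇒≢0 β-pos) (begin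
      K z * W * β     ≡⟨ ℚ.*-assoc (K z) W β ⟩
      K z * (W * β)   ≡⟨ cong (K z *_) W*β≡α ⟩
      K z * α         ≡⟨ K*α≡W*β incr ⟩
      pathWeight z * β ∎))
    where
    open ≡-Reasoning
    L = 𝒳 N T (suc S) (suc t)
    K = λ z → Prob (step N T S t y x) (_≟ᶜ z)
    W = PP N T (suc S) t y x
    W*β≡α : W * β ≡ α
    W*β≡α = begin
      sumˡ pathWeight L * β             ≡⟨ sumˡ-*ʳ pathWeight β L ⟨
      sumˡ (λ z → pathWeight z * β) L   ≡⟨ (sumˡ-cong L λ z z∈L →
                                             K*α≡W*β (proj₂ (∈-filter⁻ increasing? {xs = vectors N (𝔛 N T (suc S) (suc t))} z∈L))) ⟨
      sumˡ (λ z → K z * α) L            ≡⟨ sumˡ-*ʳ K α L ⟩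
      sumˡ K L * α                      ≡⟨ cong (_* α) (sumˡ-Prob _≟ᶜ_ (step N T S t y x)
                                             (𝒳-Unique N T (suc S) (suc t))
                                             (Almost-map (step N T S t y x)
                                               (Almost-step N T S valid-x valid-y near)
                                               λ _ → Valid⇒∈𝒳 N T (suc S) (suc t) ∘ proj₁)) ⟩
      1ℚ * α                            ≡⟨ ℚ.*-identityˡ α ⟩
      α                                 ∎
    -- No intermediate configuration is exhibited: W * β = α with α and β positive already gives the
    -- sign.
    0<PP : 0ℚ ℚ.< W
    0<PP = ℚ.*-cancelʳ-<-nonNeg β {{ℚ.pos⇒nonNeg β {{ℚ.positive β-pos}}}}
      (subst₂ ℚ._<_ (sym (ℚ.*-zeroˡ β)) (sym W*β≡α) 0<α)

  -- An up step followed by a down step always joins near configurations, so every summand of the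
  -- entry is 0. The algorithm is stuck whichever points are sampled to stay. This case covers
  -- targets Y′ incompatible with X.
  transition-¬near : ¬ AllNear y x → Transition
  transition-¬near ¬near = inj₂ PP≡0 , λ {z} incr → trans (K≡0 z)
    (sym (trans (cong (pathWeight z ÷₀_) PP≡0) (÷₀-zeroʳ (pathWeight z))))
    where
    staying = stayingPoints N T S t (blocks (coincidences y x))
    K≡0 : ∀ z → Prob (step N T S t y x) (_≟ᶜ z) ≡ 0ℚ
    K≡0 z = trans (Prob≡E (step N T S t y x) (_≟ᶜ z))
      (trans (E->>= staying (λ stay → newPoints N T S stay y x) (λ v → ind (v ≟ᶜ z)))
      (trans (E-cong staying λ stay → cong (λ m → E m (λ v → ind (v ≟ᶜ z)))
        (newPoints-stuck N T S stay y x ¬near)) (E-0 staying)))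
    sumˡ-0 : ∀ (f : Configuration N → ℚ) L → (∀ z → f z ≡ 0ℚ) → sumˡ f L ≡ 0ℚ
    sumˡ-0 f []      f≡0 = refl
    sumˡ-0 f (z ∷ L) f≡0 = cong₂ ℚ._+_ (f≡0 z) (sumˡ-0 f L f≡0)
    PP≡0 : PP N T (suc S) t y x ≡ 0ℚ
    PP≡0 = sumˡ-0 pathWeight (𝒳 N T (suc S) (suc t)) λ z → pathWeight-¬steps {z} λ (up , down) →
      ¬near λ i → Choice⇒Near (steps⇒Choice (up i) (down i))

  transition : Transition
  transition with allNear? y x
  ... | yes near = transition-near near
  ... | no ¬near = transition-¬near ¬near

-- Families of paths

-- For g the denominators and k the step probabilities: a single vanishing denominator makes the
-- matrix entry 0 by definition, and the probability of the whole family is 0 as well because its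
-- factor at that time vanishes.
Πℚ-pos⊎zero : ∀ {n} (g k : Fin n → ℚ) → (∀ i → 0ℚ ℚ.< g i ⊎ g i ≡ 0ℚ) → (∀ i → g i ≡ 0ℚ → k i ≡ 0ℚ) →
  0ℚ ℚ.< Πℚ g ⊎ (Πℚ g ≡ 0ℚ × Πℚ k ≡ 0ℚ)
Πℚ-pos⊎zero {zero}  g k sign g⇒k = inj₁ (ℚ.positive⁻¹ 1ℚ)
Πℚ-pos⊎zero {suc n} g k sign g⇒k
  with sign Fin.zero | Πℚ-pos⊎zero (g ∘ Fin.suc) (k ∘ Fin.suc) (sign ∘ Fin.suc) (g⇒k ∘ Fin.suc)
... | inj₂ g≡0 | _          = inj₂ (*-≡0ˡ _ g≡0 , *-≡0ˡ _ (g⇒k Fin.zero g≡0))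
... | inj₁ 0<g | inj₁ 0<Πg  = inj₁ (*-pos 0<g 0<Πg)
... | inj₁ 0<g | inj₂ (Πg≡0 , Πk≡0) = inj₂
  ( trans (cong (g Fin.zero *_) Πg≡0) (ℚ.*-zeroʳ (g Fin.zero))
  , trans (cong (k Fin.zero *_) Πk≡0) (ℚ.*-zeroʳ (k Fin.zero)))

unitStep-≤ : ∀ {i j} → j - i ≡ 0ℤ ⊎ j - i ≡ 1ℤ → i ≤ᶻ j × j ≤ᶻ i + 1ℤ
unitStep-≤ {i} {j} (inj₁ p) with refl ← ℤ.i-j≡0⇒i≡j j i p = ℤ.≤-refl , ℤ.<⇒≤ (i<i+1 i)
unitStep-≤ {i} {j} (inj₂ p) with refl ← i-j≡k⇒i≡j+k {j} {i} p = ℤ.<⇒≤ (i<i+1 i) , ℤ.≤-refl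

UnitSteps : ∀ {T} → (Fin (suc T) → ℤ) → Set
UnitSteps {T} p = ∀ (t : Fin T) → p (Fin.suc t) - p (inject₁ t) ≡ 0ℤ ⊎ p (Fin.suc t) - p (inject₁ t) ≡ 1ℤ

path-from-start : ∀ {T} (p : Fin (suc T) → ℤ) → UnitSteps p →
  ∀ t → p Fin.zero ≤ᶻ p t × p t ≤ᶻ p Fin.zero + + toℕ t
path-from-start p steps Fin.zero = ℤ.≤-refl , ℤ.≤-reflexive (sym (ℤ.+-identityʳ (p Fin.zero)))
path-from-start {suc T} p steps (Fin.suc t)
  with p₀≤p₁ , p₁≤p₀+1 ← unitStep-≤ {p Fin.zero} (steps Fin.zero)
     | p₁≤ , ≤p₁+t ← path-from-start (p ∘ Fin.suc) (steps ∘ Fin.suc) t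
  = ℤ.≤-trans p₀≤p₁ p₁≤
  , ℤ.≤-trans ≤p₁+t (ℤ.≤-trans (ℤ.+-monoˡ-≤ (+ toℕ t) p₁≤p₀+1)
      (ℤ.≤-reflexive (ℤ.+-assoc (p Fin.zero) 1ℤ (+ toℕ t))))

-- The second bound is p(T) - p(t) ≤ T - t without subtraction; for a path ending at S + i it yields
-- the lower bound t + S - T. Removing initial times reduces to t = 0, where `path-from-start`
-- applies.
path-to-end : ∀ {T} (p : Fin (suc T) → ℤ) → UnitSteps p →
  ∀ t → p t ≤ᶻ p (fromℕ T) × p (fromℕ T) + + toℕ t ≤ᶻ p t + + T
path-to-end {T} p steps Fin.zero with p₀≤ , ≤p₀+T ← path-from-start p steps (fromℕ T)
  rewrite Fin.toℕ-fromℕ T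
  = p₀≤ , ℤ.≤-trans (ℤ.≤-reflexive (ℤ.+-identityʳ _)) ≤p₀+T
path-to-end {suc T} p steps (Fin.suc t) with ≤pT , pT+t≤ ← path-to-end (p ∘ Fin.suc) (steps ∘ Fin.suc) t
  = ≤pT , ≤-gap (gap-≤ pT+t≤) (eq (p (Fin.suc t)) (p (fromℕ (suc T))) (+ T) (+ toℕ t))
  where
  eq : ∀ p q T t → p + T - (q + t) ≡ p + (1ℤ + T) - (q + (1ℤ + t))
  eq = solve-∀

Ω⇒Valid : ∀ {N T S X} → X ∈ Ω N T S → ∀ t → Valid T S (toℕ t) (lookup X t)
Ω⇒Valid {N} {T} {S} {X} X∈Ω t = record
  { increasing = increasing t
  ; 0≤     = λ i → ℤ.≤-trans (0≤+ (toℕ i)) (subst (_≤ᶻ p i t) (start i) (proj₁ (fwd i)))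
  ; t+S-T≤ = λ i → ≤-gap
      (gap-≤ (subst (λ e → e + + toℕ t ≤ᶻ p i t + + T) (end i) (proj₂ (bwd i))) ⊕ 0≤+ (toℕ i))
      (eq (p i t) (+ T) (+ S) (+ toℕ i) (+ toℕ t))
  ; ≤S+i   = λ i → subst (p i t ≤ᶻ_) (end i) (proj₁ (bwd i))
  ; ≤t+i   = λ i → subst (p i t ≤ᶻ_) (ℤ.+-comm (+ toℕ i) (+ toℕ t))
      (subst (λ s → p i t ≤ᶻ s + + toℕ t) (start i) (proj₂ (fwd i)))
  }
  where
  open Ω X∈Ω
  p : Fin N → Fin (suc T) → ℤ
  p i t = lookup (lookup X t) i
  fwd = λ i → path-from-start (p i) (λ t → steps t i) t
  bwd = λ i → path-to-end (p i) (λ t → steps t i) t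
  eq : ∀ p T S i t → p + T - (S + i + t) + i ≡ p - (t + S - T)
  eq = solve-∀

Increasing⇒≥ : ∀ {N m} (x : Configuration N) → Increasing x → (∀ i → m ≤ᶻ lookup x i) →
  ∀ i → m + + toℕ i ≤ᶻ lookup x i
Increasing⇒≥ {m = m} (x ∷ xs) inc m≤x Fin.zero    = subst (_≤ᶻ x) (sym (ℤ.+-identityʳ m)) (m≤x Fin.zero)
Increasing⇒≥ {m = m} (x ∷ xs) inc m≤x (Fin.suc i) = subst (_≤ᶻ lookup xs i) (ℤ.+-assoc m 1ℤ (+ toℕ i))
  (Increasing⇒≥ xs (Increasing-tail inc)
    (λ j → ℤ.≤-trans (ℤ.+-monoˡ-≤ 1ℤ (m≤x Fin.zero)) (<⇒+1≤ (inc Fin.zero (Fin.suc j) (ℕ.s≤s ℕ.z≤n)))) i)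

-- The endpoint is forced by the bounds: at t = T the lower bound is S, so the strictly increasing
-- coordinates satisfy x_i ≥ S + i, which meets the sharpened upper bound.
Valid⇒Ω : ∀ {N T S X} → (∀ i → lookup (lookup X Fin.zero) i ≡ + toℕ i) →
  (∀ t → UpStep (lookup X (inject₁ t)) (lookup X (Fin.suc t))) →
  (∀ t → Valid T S (toℕ t) (lookup X t)) → X ∈ Ω N T S
Valid⇒Ω {N} {T} {S} {X} start steps valid = record
  { start      = start
  ; end        = λ i → ℤ.≤-antisym (≤S+i i) (Increasing⇒≥ (lookup X (fromℕ T)) increasing S≤ i)
  ; steps      = steps
  ; increasing = λ t → Valid.increasing (valid t)
  }
  where
  open Valid (valid (fromℕ T))
  S≤ : ∀ i → + S ≤ᶻ lookup (lookup X (fromℕ T)) i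
  S≤ i = subst (_≤ᶻ lookup (lookup X (fromℕ T)) i)
    (trans (cong (λ t → + t + + S - + T) (Fin.toℕ-fromℕ T)) (eq (+ T) (+ S))) (t+S-T≤ i)
    where
    eq : ∀ T S → T + S - T ≡ S
    eq = solve-∀

steps⇒Near : ∀ {y x x′} → x - y ≡ -1ℤ ⊎ x - y ≡ 0ℤ → x′ - x ≡ 0ℤ ⊎ x′ - x ≡ 1ℤ → Near y x′
steps⇒Near {y} {x} {x′} p q = case p q
  where
  eq : ∀ y x x′ → x′ - y ≡ (x′ - x) + (x - y)
  eq = solve-∀
  sum-eq : ∀ {a b} → x′ - x ≡ a → x - y ≡ b → x′ - y ≡ a + b
  sum-eq q p = trans (eq y x x′) (cong₂ _+_ q p)
  case : x - y ≡ -1ℤ ⊎ x - y ≡ 0ℤ → x′ - x ≡ 0ℤ ⊎ x′ - x ≡ 1ℤ → Near y x′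
  case (inj₁ p) (inj₁ q) = inj₂ (inj₁ (sum-eq q p))
  case (inj₁ p) (inj₂ q) = inj₂ (inj₂ (ℤ.i-j≡0⇒i≡j x′ y (sum-eq q p)))
  case (inj₂ p) (inj₁ q) = inj₂ (inj₂ (ℤ.i-j≡0⇒i≡j x′ y (sum-eq q p)))
  case (inj₂ p) (inj₂ q) = inj₁ (sum-eq q p)

module _ (N T S : ℕ) where

  -- Here x stands for X(t), the row just left behind. The invariant `DownStep y x`, combined with
  -- the up step from X(t) to X(t+1), makes y near X(t+1), and the new row is again one down step
  -- away from X(t+1).
  Almost-run : ∀ {m} t (y x : Configuration N) (xs : Vec (Configuration N) m) →
    Valid T (suc S) t y → DownStep y x →
    (∀ j → UpStep (lookup (x ∷ xs) (inject₁ j)) (lookup xs j)) →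
    (∀ j → Valid T S (suc t ℕ.+ toℕ j) (lookup xs j)) →
    Almost (λ zs → (∀ j → UpStep (lookup (y ∷ zs) (inject₁ j)) (lookup zs j)) ×
                   (∀ j → Valid T (suc S) (t ℕ.+ toℕ j) (lookup (y ∷ zs) j)))
      (run N T S t y xs)
  Almost-run t y x [] valid-y down ups valid-xs = (λ ()) ,
    λ { Fin.zero → subst (λ s → Valid T (suc S) s y) (sym (ℕ.+-identityʳ t)) valid-y }
  Almost-run t y x (x′ ∷ xs) valid-y down ups valid-xs = Almost->>= (step N T S t y x′)
    (Almost-step N T S valid-x′ valid-y λ i → steps⇒Near {x = lookup x i} (down i) (ups Fin.zero i))
    λ z (valid-z , up , down′) → Almost->>= (run N T S (suc t) z xs)
      (Almost-run (suc t) z x′ xs valid-z down′ (ups ∘ Fin.suc)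
        (λ j → subst (λ s → Valid T S (suc s) (lookup xs j)) (ℕ.+-suc t (toℕ j)) (valid-xs (Fin.suc j))))
      λ zs (ups′ , valid-zs) →
        (λ { Fin.zero → up ; (Fin.suc j) → ups′ j }) ,
        (λ { Fin.zero → subst (λ s → Valid T (suc S) s y) (sym (ℕ.+-identityʳ t)) valid-y
           ; (Fin.suc j) → subst (λ s → Valid T (suc S) s (lookup (z ∷ zs) j))
               (sym (ℕ.+-suc t (toℕ j))) (valid-zs j) })
    where
    valid-x′ : Valid T S (suc t) x′
    valid-x′ = subst (λ s → Valid T S s x′) (ℕ.+-identityʳ (suc t)) (valid-xs Fin.zero)

  y₀ : Configuration N
  y₀ = tabulate λ i → + toℕ i

  lookup-y₀ : ∀ i → lookup y₀ i ≡ + toℕ i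
  lookup-y₀ = Vec.lookup∘tabulate _

  Valid-y₀ : S < T → Valid T (suc S) 0 y₀
  Valid-y₀ S<T = record
    { increasing = λ i j i<j → subst₂ _<ᶻ_ (sym (lookup-y₀ i)) (sym (lookup-y₀ j)) (ℤ.+<+ i<j)
    ; 0≤     = λ i → subst (0ℤ ≤ᶻ_) (sym (lookup-y₀ i)) (0≤+ (toℕ i))
    -- The hypothesis S < T enters here: at t = 0 the lower bound S + 1 - T is at most 0.
    ; t+S-T≤ = λ i → subst (0ℤ + + suc S - + T ≤ᶻ_) (sym (lookup-y₀ i))
        (≤-gap (gap-≤ (ℤ.+≤+ S<T) ⊕ 0≤+ (toℕ i)) (eq (+ T) (+ suc S) (+ toℕ i)))
    ; ≤S+i   = λ i → subst (_≤ᶻ + suc S + + toℕ i) (sym (lookup-y₀ i)) (ℤ.+≤+ (ℕ.m≤n+m (toℕ i) (suc S)))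
    ; ≤t+i   = λ i → ℤ.≤-reflexive (lookup-y₀ i)
    }
    where
    eq : ∀ T s i → T - s + i ≡ i - (0ℤ + s - T)
    eq = solve-∀

  Almost-algorithm : S < T → ∀ {X} → X ∈ Ω N T S → Almost (Ω N T (suc S)) (algorithm N T S X)
  Almost-algorithm S<T {x₀ ∷ xs} X∈Ω = Almost->>= (run N T S 0 y₀ xs)
    (Almost-run 0 y₀ x₀ xs (Valid-y₀ S<T)
      (λ i → inj₂ (ℤ.i≡j⇒i-j≡0 (trans (start i) (sym (lookup-y₀ i)))))
      steps (Ω⇒Valid X∈Ω ∘ Fin.suc))
    λ zs (ups , valid) → Valid⇒Ω lookup-y₀ ups valid
    where open Ω X∈Ω

  Prob-run : ∀ {m} t y (xs zs : Vec (Configuration N) m) →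
    Prob (run N T S t y xs) (λ v → Vec.≡-dec _≟ᶜ_ v zs) ≡
    Πℚ λ j → Prob (step N T S (t ℕ.+ toℕ j) (lookup (y ∷ zs) (inject₁ j)) (lookup xs j)) (_≟ᶜ lookup zs j)
  Prob-run t y []       []       = refl
  Prob-run t y (x ∷ xs) (z ∷ zs) = trans
    (Prob-∷ _≟ᶜ_ (step N T S t y x) (λ b → run N T S (suc t) b xs) z zs)
    (cong₂ _*_
      (cong (λ s → Prob (step N T S s y x) (_≟ᶜ z)) (sym (ℕ.+-identityʳ t)))
      (trans (Prob-run (suc t) z xs zs) (Πℚ-cong λ j →
        cong (λ s → Prob (step N T S s (lookup (z ∷ zs) (inject₁ j)) (lookup xs j)) (_≟ᶜ lookup zs j))
          (sym (ℕ.+-suc t (toℕ j))))))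

  Prob-algorithm : ∀ X {Y} → (∀ i → lookup (lookup Y Fin.zero) i ≡ + toℕ i) →
    Prob (algorithm N T S X) (_≟ᶠ Y) ≡
    Πℚ λ t → Prob (step N T S (toℕ t) (lookup Y (inject₁ t)) (lookup X (Fin.suc t))) (_≟ᶜ lookup Y (Fin.suc t))
  Prob-algorithm (x₀ ∷ xs) {y ∷ ys} start
    with refl ← trans (sym (Vec.tabulate∘lookup y)) (Vec.tabulate-cong start)
    = begin
      -- The initial row is treated as a deterministic first draw, so that `Prob-∷` also splits off
      -- time 0.
      Prob (return y₀ >>= λ b → run N T S 0 b xs >>= λ bs → return (b ∷ bs)) (_≟ᶠ (y₀ ∷ ys))
        ≡⟨ Prob-∷ _≟ᶜ_ (return y₀) (λ b → run N T S 0 b xs) y₀ ys ⟩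
      ind (y₀ ≟ᶜ y₀) * Prob (run N T S 0 y₀ xs) (λ v → Vec.≡-dec _≟ᶜ_ v ys)
        ≡⟨ cong₂ _*_ (ind-yes (y₀ ≟ᶜ y₀) refl) (Prob-run 0 y₀ xs ys) ⟩
      1ℚ * q
        ≡⟨ ℚ.*-identityˡ q ⟩
      q ∎
    where
    open ≡-Reasoning
    q = Πℚ λ t → Prob (step N T S (toℕ t) (lookup (y₀ ∷ ys) (inject₁ t)) (lookup xs t)) (_≟ᶜ lookup ys t)

  Prob-algorithm≡P : ∀ {X Y} → X ∈ Ω N T S → Y ∈ Ω N T (suc S) →
    Prob (algorithm N T S X) (_≟ᶠ Y) ≡ P-S↦S+1 N T S X Y
  Prob-algorithm≡P {X} {Y} X∈Ω Y∈Ω = trans (Prob-algorithm X (Ω.start Y∈Ω)) (case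
    (Πℚ-pos⊎zero denominator prob (λ t → proj₁ (transitions t))
      (λ t den≡0 → trans (prob≡ t) (trans (cong (numerator t ÷₀_) den≡0) (÷₀-zeroʳ (numerator t))))))
    where
    numerator denominator prob : Fin T → ℚ
    numerator t =
      P-t+ N T (suc S) (toℕ t) (lookup Y (inject₁ t)) (lookup Y (Fin.suc t))
      * P-S- N T (suc S) (suc (toℕ t)) (lookup Y (Fin.suc t)) (lookup X (Fin.suc t))
    denominator t = PP N T (suc S) (toℕ t) (lookup Y (inject₁ t)) (lookup X (Fin.suc t))
    prob t = Prob (step N T S (toℕ t) (lookup Y (inject₁ t)) (lookup X (Fin.suc t))) (_≟ᶜ lookup Y (Fin.suc t))

    valid-y : ∀ t → Valid T (suc S) (toℕ t) (lookup Y (inject₁ t))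
    valid-y t = subst (λ s → Valid T (suc S) s (lookup Y (inject₁ t))) (Fin.toℕ-inject₁ t)
      (Ω⇒Valid Y∈Ω (inject₁ t))

    transitions : ∀ t → Transition N T S (toℕ t) (Fin.toℕ<n t) (valid-y t) (Ω⇒Valid X∈Ω (Fin.suc t))
    transitions t = transition N T S (toℕ t) (Fin.toℕ<n t) (valid-y t) (Ω⇒Valid X∈Ω (Fin.suc t))

    prob≡ : ∀ t → prob t ≡ numerator t ÷₀ denominator t
    prob≡ t = proj₂ (transitions t) (Ω.increasing Y∈Ω (Fin.suc t))

    case : 0ℚ ℚ.< Πℚ denominator ⊎ (Πℚ denominator ≡ 0ℚ × Πℚ prob ≡ 0ℚ) → Πℚ prob ≡ P-S↦S+1 N T S X Y
    case (inj₁ 0<den) = trans (Πℚ-cong prob≡)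
      (cong (λ b → if b then Πℚ (λ t → numerator t ÷₀ denominator t) else 0ℚ)
        (sym (dec-true (0ℚ ℚ.<? Πℚ denominator) 0<den)))
    case (inj₂ (den≡0 , prob≡0)) = trans prob≡0
      (cong (λ b → if b then Πℚ (λ t → numerator t ÷₀ denominator t) else 0ℚ)
        (sym (dec-false (0ℚ ℚ.<? Πℚ denominator) (ℚ.<-irrefl (sym den≡0)))))

theorem4p1 : (N T S : ℕ) → 1 ≤ N → 1 ≤ T → S < T →
    (X : Family N T) → X ∈ Ω N T S →
    Prob (algorithm N T S X) (Ω? N T (suc S)) ≡ 1ℚ ×
    (∀ (Y′ : Family N T) → Y′ ∈ Ω N T (suc S) →
    Prob (algorithm N T S X) (_≟ᶠ Y′) ≡ P-S↦S+1 N T S X Y′)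
theorem4p1 N T S _ _ S<T X X∈Ω =
  Almost⇒Prob≡1 (Ω? N T (suc S)) (algorithm N T S X) (Almost-algorithm N T S S<T X∈Ω) ,
  λ Y′ Y′∈Ω → Prob-algorithm≡P N T S X∈Ω Y′∈Ω
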